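{- There are infinitely many finite words $w\in\{0,1\}^*$ such that $$|\mathrm{Dict}(0w)|\geq \frac{1}{35}\sqrt{|w|\cdot|\mathrm{Dict}(w)|}.$$
   Context: The LZ'78 parsing of a finite binary word $w$ is the unique factorization $w=m_1m_2\cdots m_k$ into nonempty words (blocks) such that $m_1,\dots,m_{k-1}$ are pairwise distinct and, for every $i\le k$, every nonempty prefix of $m_i$ belongs to $\{m_1,\dots,m_i\}$. The dictionary is $\mathrm{Dict}(w)=\{m_1,\dots,m_k\}$. $0w$ is the word obtained by prepending the letter $0$ to $w$. -}

module Defs where

open import Data.Bool using (Bool; false; true)
open import Data.Bool.Properties using () renaming (_≟_ to _≟B_)
open import Data.List using (List; []; _∷_; _++_; concat; length; deduplicate)
open import Data.List.Properties using (≡-dec)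
open import Data.List.Membership.Propositional using (_∈_; _∉_)
open import Data.Nat using (ℕ)
open import Data.Product using (Σ; _×_; ∃)
open import Data.Unit using (⊤)
open import Relation.Binary.PropositionalEquality using (_≡_; _≢_)

-- Binary words; the letter 0 is `false`, the letter 1 is `true`.
Word : Set
Word = List Bool

NonemptyPrefix : Word → Word → Set
NonemptyPrefix p m = p ≢ [] × ∃ λ q → p ++ q ≡ m

-- LZ-conditions on the remaining blocks, given the earlier blocks `prev`
-- (stored in reverse order; only membership in `prev` matters):
--  * every block is nonempty,
--  * every nonempty prefix of a block m_i lies in {m_1,…,m_i},
--  * every block other than the last is distinct from all earlier blocks
--    (hence m_1,…,m_{k-1} are pairwise distinct).
LZBlocks : List Word → List Word → Set
LZBlocks prev []           = ⊤
LZBlocks prev (m ∷ rest) =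
  m ≢ [] ×
  (∀ p → NonemptyPrefix p m → p ∈ (m ∷ prev)) ×
  (rest ≢ [] → m ∉ prev) ×
  LZBlocks (m ∷ prev) rest

IsLZParsing : Word → List Word → Set
IsLZParsing w ms = concat ms ≡ w × LZBlocks [] ms

dictSize : List Word → ℕ
dictSize ms = length (deduplicate (≡-dec _≟B_) ms)

{-# OPTIONS --safe #-}

-- Let p_i = y[0..i) for a sequence y whose windows of length ℓ₀ are pairwise different, put L = 2 + 2ℓ₀,
-- and let w be p_1 p_2 … p_X p_{X+1} … p_{X+C}, with a spacer 01^m inserted in front of some of the last C
-- words. All these are blocks of w, so Dict(w) is small. In 0w the first X words are blocks too, but then
-- 0w loses synchronisation, and the spacers, which 0w always has one step earlier than w, prevent it from
-- ever being in step with w again. A block win z ℓ of 0w with ℓ ≥ L determines its position z in its copy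
-- p_i. Hence a long block starting at z needs many blocks starting at z in different copies, their
-- predecessors start at many different q, and, the dictionary being prefix-closed, these lead to more
-- blocks across some position left of z than there are copies. So with C = H² and L = H nearly all blocks
-- of 0w have length O(H), although those of w have length of order H²; counting gives H³ blocks of 0w
-- against fewer than 9H² blocks of w, of length at most 8H².
module Submission where

open import Defs
open import Data.Bool using (Bool; true; false)
open import Data.Bool.Properties using () renaming (_≟_ to _≟B_)
open import Data.Empty using (⊥-elim)
open import Data.List using (List; []; _∷_; _++_; _ʳ++_; map; concat; length; replicate; upTo; filter; cartesianProduct)
open import Data.List.Properties using (≡-dec; length-++; ++-assoc; ++-identityʳ; ++-conicalˡ; ++-conicalʳ; length-replicate; length-upTo; length-map; ∷-injective; length-deduplicate; length-ʳ++)
open import Data.List.Membership.Propositional using (_∈_; _∉_)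
open import Data.List.Membership.Propositional.Properties
import Data.List.Membership.DecPropositional as DecMembership
open import Data.List.Relation.Unary.All as All using (All)
open import Data.List.Relation.Unary.AllPairs using ([]; _∷_)
open import Data.List.Relation.Unary.Any using (here; there)
open import Data.List.Relation.Unary.Unique.Propositional using (Unique)
import Data.List.Relation.Unary.Unique.Propositional.Properties as Unique
open import Data.Nat
open import Data.Nat.DivMod using (m≡m%n+[m/n]*n; m%n<n; [m+kn]%n≡m%n; m<n⇒m%n≡m; m<n*o⇒m/o<n; m*n/n≡m; /-monoˡ-≤)
open import Data.Nat.Properties
open import Data.Nat.Solver using (module +-*-Solver)
open import Data.Product using (_×_; _,_; ∃; ∃₂; proj₁; proj₂; map₁; map₂)
open import Data.Sum as Sum using (_⊎_; inj₁; inj₂)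
open import Data.Unit using (⊤; tt)
open import Function using (_∘_; case_of_)
open import Relation.Binary.PropositionalEquality
open import Relation.Nullary using (¬_; Dec; does; yes; no; contradiction; _×-dec_; _⊎-dec_)
open import Relation.Nullary.Decidable using (dec-true)
open import Relation.Unary using (Decidable)

open +-*-Solver using (solve; _:+_; _:*_; con; _:=_)

-- Counting by injective relations, and list tools.

-- No `y` serves two elements of `xs`, so removing the `y` chosen for the first one leaves images
-- for all the others. A relation in place of a function allows an element several images.
pigeonhole : ∀ {a b r} {A : Set a} {B : Set b} (R : A → B → Set r) {xs ys} → Unique xs →
             (∀ {x} → x ∈ xs → ∃ λ y → y ∈ ys × R x y) →
             (∀ {x x′ y} → R x y → R x′ y → x ≡ x′) → length xs ≤ length ys
pigeonhole R {[]} _ _ _ = z≤n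
pigeonhole R {x ∷ xs} (x∉xs ∷ unique) image injective with image (here refl)
... | y , y∈ys , Rxy with ∈-∃++ y∈ys
... | as , bs , refl = begin
  suc (length xs)              ≤⟨ s≤s (pigeonhole R unique image′ injective) ⟩
  suc (length (as ++ bs))      ≡⟨ cong suc (length-++ as) ⟩
  suc (length as + length bs)  ≡⟨ +-suc (length as) (length bs) ⟨
  length as + suc (length bs)  ≡⟨ length-++ as ⟨
  length (as ++ y ∷ bs)        ∎
  where
  open ≤-Reasoning
  image′ : ∀ {x′} → x′ ∈ xs → ∃ λ y′ → y′ ∈ as ++ bs × R x′ y′
  image′ x′∈xs with image (there x′∈xs)
  ... | y′ , y′∈ , Rx′y′ with ∈-++⁻ as y′∈
  ... | inj₁ y′∈as = y′ , ∈-++⁺ˡ y′∈as , Rx′y′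
  ... | inj₂ (there y′∈bs) = y′ , ∈-++⁺ʳ as y′∈bs , Rx′y′
  ... | inj₂ (here refl) = contradiction (injective Rxy Rx′y′) (All.lookup x∉xs x′∈xs)

-- This is the greedy step of the parsing: with `P k` saying that the candidate of length `k` is a
-- known word, the first failure is the next block, and no failure means that the text ends inside a
-- block.
firstFailure : ∀ {p} {P : ℕ → Set p} → Decidable P → ∀ n →
  (∀ {k} → 1 ≤ k → k ≤ n → P k) ⊎
  (∃ λ k → 1 ≤ k × k ≤ n × ¬ P k × (∀ {j} → 1 ≤ j → j < k → P j))
firstFailure P? zero = inj₁ λ 1≤k k≤0 → contradiction (≤-trans 1≤k k≤0) λ ()
firstFailure P? (suc n) with firstFailure P? n
... | inj₂ (k , 1≤k , k≤n , ¬Pk , before) = inj₂ (k , 1≤k , m≤n⇒m≤1+n k≤n , ¬Pk , before)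
... | inj₁ upto with P? (suc n)
... | no ¬P = inj₂ (suc n , s≤s z≤n , ≤-refl , ¬P , λ 1≤j j≤n → upto 1≤j (s≤s⁻¹ j≤n))
... | yes P = inj₁ λ 1≤k k≤1+n → case m≤n⇒m<n∨m≡n k≤1+n of λ where
  (inj₁ k<1+n) → upto 1≤k (s≤s⁻¹ k<1+n)
  (inj₂ refl) → P

++-split : ∀ {a} {A : Set a} (as : List A) {bs cs ds} → as ++ bs ≡ cs ++ ds → length as ≤ length cs →
           ∃ λ es → cs ≡ as ++ es × bs ≡ es ++ ds
++-split [] {cs = cs} eq _ = cs , refl , eq
++-split (a ∷ as) {cs = c ∷ cs} eq (s≤s le) with ∷-injective eq
... | refl , eq′ with ++-split as {cs = cs} eq′ le
... | es , cs≡ , bs≡ = es , cong (a ∷_) cs≡ , bs≡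

nonempty : ∀ {a} {A : Set a} {xs : List A} → xs ≢ [] → 1 ≤ length xs
nonempty {xs = []} ≢[] = contradiction refl ≢[]
nonempty {xs = _ ∷ _} _ = s≤s z≤n

-- Dictionaries of complete blocks and their relation to parsings.

-- Latest block first.
Dict : List Word → Set
Dict [] = ⊤
Dict (m ∷ D) = m ≢ [] × (∀ p → NonemptyPrefix p m → p ∈ m ∷ D) × m ∉ D × Dict D

prefix-closed : ∀ {D p q} → Dict D → p ++ q ∈ D → p ≢ [] → p ∈ D
prefix-closed {m ∷ D} {p} {q} (_ , prefixes , _) (here eq) p≢[] = prefixes p (p≢[] , q , eq)
prefix-closed {m ∷ D} (_ , _ , _ , dict) (there pq∈D) p≢[] = there (prefix-closed dict pq∈D p≢[])

[]∉dict : ∀ {D} → Dict D → [] ∉ D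
[]∉dict {m ∷ D} (m≢[] , _) (here []≡m) = m≢[] (sym []≡m)
[]∉dict {m ∷ D} (_ , _ , _ , dict) (there []∈D) = []∉dict dict []∈D

dict-unique : ∀ {D} → Dict D → Unique D
dict-unique {[]} _ = []
dict-unique {m ∷ D} (_ , _ , m∉D , dict) =
  All.tabulate (λ { x∈D refl → m∉D x∈D }) ∷ dict-unique dict

spell : List Word → Word
spell [] = []
spell (m ∷ D) = spell D ++ m

concat-ʳ++ : ∀ D {ms} → concat (D ʳ++ ms) ≡ spell D ++ concat ms
concat-ʳ++ [] = refl
concat-ʳ++ (m ∷ D) {ms} = trans (concat-ʳ++ D) (sym (++-assoc (spell D) m (concat ms)))

lzBlocks-ʳ++ : ∀ D {ms} → Dict D → LZBlocks D ms → LZBlocks [] (D ʳ++ ms)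
lzBlocks-ʳ++ [] _ blocks = blocks
lzBlocks-ʳ++ (m ∷ D) (m≢[] , prefixes , m∉D , dict) blocks =
  lzBlocks-ʳ++ D dict (m≢[] , prefixes , (λ _ → m∉D) , blocks)

-- The last block of a parsing may repeat an earlier one, so a rest that is empty or already known
-- closes the parsing.
unfinished-block : ∀ {D u} → Dict D → u ≡ [] ⊎ u ∈ D → ∃ λ ms → concat ms ≡ u × LZBlocks D ms
unfinished-block _ (inj₁ refl) = [] , refl , tt
unfinished-block {D} {u} dict (inj₂ u∈D) = u ∷ [] , ++-identityʳ u ,
  (λ { refl → []∉dict dict u∈D }) ,
  (λ { p (p≢[] , q , eq) → there (prefix-closed dict (subst (_∈ D) (sym eq) u∈D) p≢[]) }) ,
  contradiction refl , tt

∈-ʳ++ : ∀ {a} {A : Set a} (xs : List A) {ys x} → x ∈ xs ⊎ x ∈ ys → x ∈ xs ʳ++ ys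
∈-ʳ++ [] (inj₂ x∈ys) = x∈ys
∈-ʳ++ (_ ∷ xs) (inj₁ (here refl)) = ∈-ʳ++ xs (inj₂ (here refl))
∈-ʳ++ (_ ∷ xs) (inj₁ (there x∈xs)) = ∈-ʳ++ xs (inj₁ x∈xs)
∈-ʳ++ (_ ∷ xs) (inj₂ x∈ys) = ∈-ʳ++ xs (inj₂ (there x∈ys))

length≤dictSize : ∀ {D} ms → Dict D → length D ≤ dictSize (D ʳ++ ms)
length≤dictSize {D} ms dict = pigeonhole _≡_ (dict-unique dict)
  (λ {x} x∈D → x , ∈-deduplicate⁺ (≡-dec _≟B_) (∈-ʳ++ D (inj₁ x∈D)) , refl)
  (λ { refl refl → refl })

length-spell-≤ : ∀ {n} D → (∀ {m} → m ∈ D → length m ≤ n) → length (spell D) ≤ length D * n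
length-spell-≤ [] _ = z≤n
length-spell-≤ {n} (m ∷ D) short = begin
  length (spell D ++ m)        ≡⟨ length-++ (spell D) ⟩
  length (spell D) + length m  ≤⟨ +-mono-≤ (length-spell-≤ D (short ∘ there)) (short (here refl)) ⟩
  length D * n + n             ≡⟨ +-comm (length D * n) n ⟩
  n + length D * n             ∎
  where open ≤-Reasoning

length≤spell : ∀ {D} → Dict D → length D ≤ length (spell D)
length≤spell {[]} _ = z≤n
length≤spell {m ∷ D} (m≢[] , _ , _ , dict) = begin
  suc (length D)               ≡⟨ +-comm 1 (length D) ⟩
  length D + 1                 ≤⟨ +-mono-≤ (length≤spell dict) (nonempty m≢[]) ⟩
  length (spell D) + length m  ≡⟨ length-++ (spell D) ⟨
  length (spell D ++ m)        ∎
  where open ≤-Reasoning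

length-cartesianProduct : ∀ {a b} {A : Set a} {B : Set b} (xs : List A) (ys : List B) →
                          length (cartesianProduct xs ys) ≡ length xs * length ys
length-cartesianProduct [] ys = refl
length-cartesianProduct (x ∷ xs) ys = trans (length-++ (map (x ,_) ys))
  (cong₂ _+_ (length-map (x ,_) ys) (length-cartesianProduct xs ys))

does-true : ∀ {p} {P : Set p} (P? : Dec P) → does P? ≡ true → P
does-true (yes p) _ = p
does-true (no _) ()

-- Windows of an infinite binary sequence.

module Windows (y : ℕ → Bool) where

  win : ℕ → ℕ → Word
  win q zero = []
  win q (suc ℓ) = y q ∷ win (suc q) ℓ

  length-win : ∀ q ℓ → length (win q ℓ) ≡ ℓ
  length-win q zero = refl
  length-win q (suc ℓ) = cong suc (length-win (suc q) ℓ)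

  win-++ : ∀ q k {ℓ} → win q k ++ win (q + k) ℓ ≡ win q (k + ℓ)
  win-++ q zero {ℓ} = cong (λ p → win p ℓ) (+-identityʳ q)
  win-++ q (suc k) {ℓ} = cong (y q ∷_)
    (trans (cong (λ p → win (suc q) k ++ win p ℓ) (+-suc q k)) (win-++ (suc q) k))

  win-split : ∀ u {s q ℓ} → u ++ s ≡ win q ℓ → u ≡ win q (length u) × s ≡ win (q + length u) (length s)
  win-split [] {s} {q} {ℓ} refl = refl ,
    cong₂ win (sym (+-identityʳ q)) (sym (length-win q ℓ))
  win-split (a ∷ u) {s} {q} {suc ℓ} eq with ∷-injective eq
  ... | refl , eq′ with win-split u eq′
  ... | u≡ , s≡ = cong (y q ∷_) u≡ , trans s≡ (cong (λ p → win p (length s)) (sym (+-suc q (length u))))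

  win-agree : ∀ {q q′} ℓ → win q ℓ ≡ win q′ ℓ → ∀ {k} → k < ℓ → y (q + k) ≡ y (q′ + k)
  win-agree {q} {q′} (suc ℓ) eq {zero} _ rewrite +-identityʳ q | +-identityʳ q′ = proj₁ (∷-injective eq)
  win-agree {q} {q′} (suc ℓ) eq {suc k} (s≤s k<ℓ) rewrite +-suc q k | +-suc q′ k =
    win-agree ℓ (proj₂ (∷-injective eq)) k<ℓ

-- A sequence whose windows of two frames are pairwise different.

-- Frames of length 6 + 2G, the n-th one being 11, 0, the unit vector of the digit n % G, 0, the unit
-- vector of the digit n / G, 0. The factor 11 occurs only at the beginning of a frame.
module Frames (G : ℕ) .{{_ : NonZero G}} where

  F : ℕ
  F = 6 + (G + G)

  Marked : ℕ → ℕ → Set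
  Marked n r = r ≡ 0 ⊎ r ≡ 1 ⊎ r ≡ 3 + n % G ⊎ r ≡ 4 + (G + n / G)

  marked? : ∀ n r → Dec (Marked n r)
  marked? n r = (r ≟ 0) ⊎-dec (r ≟ 1) ⊎-dec (r ≟ 3 + n % G) ⊎-dec (r ≟ 4 + (G + n / G))

  frames : ℕ → Bool
  frames q = does (marked? (q / F) (q % F))

  open Windows frames

  private
    sound : ∀ {n r} → does (marked? n r) ≡ true → Marked n r
    sound {n} {r} = does-true (marked? n r)

    complete : ∀ {n r} → Marked n r → does (marked? n r) ≡ true
    complete {n} {r} = dec-true (marked? n r)

    frames-at : ∀ n {r} → r < F → frames (n * F + r) ≡ does (marked? n r)
    frames-at n {r} r<F = cong₂ (λ a b → does (marked? a b)) quotient remainder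
      where
      remainder : (n * F + r) % F ≡ r
      remainder = trans (cong (_% F) (+-comm (n * F) r)) (trans ([m+kn]%n≡m%n r n F) (m<n⇒m%n≡m r<F))
      quotient : (n * F + r) / F ≡ n
      quotient = *-cancelʳ-≡ _ n F (+-cancelˡ-≡ r _ _ (begin
        r + (n * F + r) / F * F                ≡⟨ cong (_+ (n * F + r) / F * F) remainder ⟨
        (n * F + r) % F + (n * F + r) / F * F  ≡⟨ m≡m%n+[m/n]*n (n * F + r) F ⟨
        n * F + r                              ≡⟨ +-comm (n * F) r ⟩
        r + n * F                              ∎))
        where open ≡-Reasoning

    decompose : ∀ q → q ≡ q / F * F + q % F
    decompose q = trans (m≡m%n+[m/n]*n q F) (+-comm (q % F) _)

    -- The bound includes `G` because the frame following the last usable position has number up to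
    -- `G * G`; the second unit vector therefore has `G + 1` places.
    Valid : ℕ → Set
    Valid n = n / G ≤ G

    digit₀<F : ∀ n → 3 + n % G < F
    digit₀<F n = s≤s (s≤s (s≤s (s≤s (≤-trans (<⇒≤ (m%n<n n G)) (≤-trans (m≤m+n G G) (m≤n+m (G + G) 2))))))

    digit₁<F : ∀ {n} → Valid n → 4 + (G + n / G) < F
    digit₁<F valid = s≤s (s≤s (s≤s (s≤s (s≤s (≤-trans (+-monoʳ-≤ G valid) (m≤n+m (G + G) 1))))))

    clash : ∀ {n j} → n % G ≡ G + j → ∀ {a} {A : Set a} → A
    clash {n} eq = contradiction (≤-trans (m≤m+n G _) (≤-reflexive (sym eq))) (<⇒≱ (m%n<n n G))

    consecutive : ∀ {n r} → Valid n → Marked n r → Marked n (suc r) → r ≡ 0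
    consecutive _ (inj₁ r≡0) _ = r≡0
    consecutive _ (inj₂ (inj₁ refl)) (inj₂ (inj₂ (inj₁ ())))
    consecutive _ (inj₂ (inj₁ refl)) (inj₂ (inj₂ (inj₂ ())))
    consecutive _ (inj₂ (inj₂ (inj₁ refl))) (inj₂ (inj₂ (inj₁ eq))) = contradiction eq 1+n≢n
    consecutive {n} _ (inj₂ (inj₂ (inj₁ refl))) (inj₂ (inj₂ (inj₂ eq))) =
      clash {n} (suc-injective (suc-injective (suc-injective (suc-injective eq))))
    consecutive {n} _ (inj₂ (inj₂ (inj₂ refl))) (inj₂ (inj₂ (inj₁ eq))) =
      clash {n} (sym (trans (+-suc G _) (trans (cong suc (+-suc G _)) (suc-injective (suc-injective (suc-injective eq))))))
    consecutive _ (inj₂ (inj₂ (inj₂ refl))) (inj₂ (inj₂ (inj₂ eq))) = contradiction eq 1+n≢n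

    last-unmarked : ∀ {n} → Valid n → ¬ Marked n (5 + (G + G))
    last-unmarked {n} _ (inj₂ (inj₂ (inj₁ eq))) =
      clash {n} (sym (trans (+-suc G _) (trans (cong suc (+-suc G G)) (suc-injective (suc-injective (suc-injective eq))))))
    last-unmarked {n} valid (inj₂ (inj₂ (inj₂ eq))) = contradiction
      (≤-trans (≤-reflexive (+-cancelˡ-≡ G _ _ (trans (+-suc G G) (suc-injective (suc-injective (suc-injective (suc-injective eq))))))) valid)
      1+n≰n

    -- A frame ends in 0, so a factor 11 cannot straddle two frames, and inside a frame only the two
    -- opening marks are adjacent.
    frame-start : ∀ p → Valid (p / F) → frames p ≡ true → frames (suc p) ≡ true → p ≡ p / F * F
    frame-start p valid yp yp+1 with m≤n⇒m<n∨m≡n (m%n<n p F)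
    ... | inj₂ eq = contradiction
      (subst (Marked (p / F)) (suc-injective eq) (sound yp)) (last-unmarked valid)
    ... | inj₁ 1+r<F = trans (decompose p) (trans (cong (p / F * F +_) r≡0) (+-identityʳ _))
      where
      at-next : suc p ≡ p / F * F + suc (p % F)
      at-next = trans (cong suc (decompose p)) (sym (+-suc _ _))
      r≡0 : p % F ≡ 0
      r≡0 = consecutive valid (sound yp)
        (sound (trans (sym (frames-at (p / F) 1+r<F)) (trans (cong frames (sym at-next)) yp+1)))

    -- The mark of a digit of `n` is also a mark of frame `n′`, and since the ranges of the two
    -- digits do not meet, it must mark the same digit there.
    same-frame : ∀ {n n′} → Valid n → (∀ {r} → r < F → frames (n * F + r) ≡ frames (n′ * F + r)) → n ≡ n′
    same-frame {n} {n′} valid agree = begin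
      n                    ≡⟨ m≡m%n+[m/n]*n n G ⟩
      n % G + n / G * G    ≡⟨ cong₂ (λ i j → i + j * G) digit₀ digit₁ ⟩
      n′ % G + n′ / G * G  ≡⟨ m≡m%n+[m/n]*n n′ G ⟨
      n′                   ∎
      where
      open ≡-Reasoning
      transfer : ∀ {r} → r < F → Marked n r → Marked n′ r
      transfer r<F marked = sound (trans (sym (frames-at n′ r<F))
        (trans (sym (agree r<F)) (trans (frames-at n r<F) (complete marked))))
      digit₀ : n % G ≡ n′ % G
      digit₀ with transfer (digit₀<F n) (inj₂ (inj₂ (inj₁ refl)))
      ... | inj₂ (inj₂ (inj₁ eq)) = suc-injective (suc-injective (suc-injective eq))
      ... | inj₂ (inj₂ (inj₂ eq)) = clash {n} (trans (suc-injective (suc-injective (suc-injective eq))) (sym (+-suc G _)))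
      digit₁ : n / G ≡ n′ / G
      digit₁ with transfer (digit₁<F valid) (inj₂ (inj₂ (inj₂ refl)))
      ... | inj₂ (inj₂ (inj₁ eq)) = clash {n′} (sym (trans (+-suc G _) (suc-injective (suc-injective (suc-injective eq)))))
      ... | inj₂ (inj₂ (inj₂ eq)) = +-cancelˡ-≡ G _ _ (suc-injective (suc-injective (suc-injective (suc-injective eq))))

  -- A window of two frames contains the beginning of a frame together with that whole frame.
  frames-distinct : ∀ {q q′} → q < G * G * F → q′ < G * G * F → win q (F + F) ≡ win q′ (F + F) → q ≡ q′
  frames-distinct {q} {q′} q< q′< eq = +-cancelʳ-≡ k q q′ (begin
    q + k   ≡⟨ q+k≡ ⟩
    n * F   ≡⟨ cong (_* F) (same-frame {n} {n′} (valid q<) agree) ⟩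
    n′ * F  ≡⟨ q′+k≡ ⟨
    q′ + k  ∎)
    where
    open ≡-Reasoning
    -- The distance to the first frame start strictly after `q`. It lies between 1 and `F`, so that
    -- the whole frame `n` fits into the window.
    k = F ∸ q % F
    n = suc (q / F)
    n′ = (q′ + k) / F
    k≤F : k ≤ F
    k≤F = m∸n≤m F (q % F)
    valid′ : ∀ {m} → m ≤ G * G → Valid m
    valid′ m≤ = ≤-trans (/-monoˡ-≤ G m≤) (≤-reflexive (m*n/n≡m G G))
    valid : ∀ {p} → p < G * G * F → Valid (suc (p / F))
    valid p< = valid′ (m<n*o⇒m/o<n p<)
    q+k≡ : q + k ≡ n * F
    q+k≡ = begin
      q + k                          ≡⟨ cong (_+ k) (decompose q) ⟩
      q / F * F + q % F + k          ≡⟨ +-assoc (q / F * F) (q % F) k ⟩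
      q / F * F + (q % F + k)        ≡⟨ cong (q / F * F +_) (m+[n∸m]≡n (<⇒≤ (m%n<n q F))) ⟩
      q / F * F + F                  ≡⟨ +-comm (q / F * F) F ⟩
      n * F                          ∎
    k+ : ∀ {r} → r < F → k + r < F + F
    k+ r<F = +-mono-≤-< k≤F r<F
    agree-at : ∀ {r} → r < F → frames (n * F + r) ≡ frames (q′ + k + r)
    agree-at {r} r<F = begin
      frames (n * F + r)     ≡⟨ cong (λ p → frames (p + r)) q+k≡ ⟨
      frames (q + k + r)     ≡⟨ cong frames (+-assoc q k r) ⟩
      frames (q + (k + r))   ≡⟨ win-agree (F + F) eq (k+ r<F) ⟩
      frames (q′ + (k + r))  ≡⟨ cong frames (+-assoc q′ k r) ⟨
      frames (q′ + k + r)    ∎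
    valid-n′ : Valid n′
    valid-n′ = valid′ (s≤s⁻¹ (m<n*o⇒m/o<n (subst (q′ + k <_) (+-comm (G * G * F) F) (+-mono-<-≤ q′< k≤F))))
    q′+k≡ : q′ + k ≡ n′ * F
    q′+k≡ = frame-start (q′ + k) valid-n′
      (trans (cong frames (sym (+-identityʳ (q′ + k)))) (trans (sym (agree-at (s≤s z≤n))) (trans (frames-at n (s≤s z≤n)) refl)))
      (trans (cong frames (+-comm 1 (q′ + k))) (trans (sym (agree-at (s≤s (s≤s z≤n)))) (trans (frames-at n (s≤s (s≤s z≤n))) refl)))
    agree : ∀ {r} → r < F → frames (n * F + r) ≡ frames (n′ * F + r)
    agree {r} r<F = trans (agree-at r<F) (cong (λ p → frames (p + r)) q′+k≡)

-- Positions of long windows in the sequence.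

module Construction
  (y : ℕ → Bool) (y0 : y 0 ≡ true) (ℓ₀ Z : ℕ)
  (distinct : ∀ {q q′} → q < Z → q′ < Z → Windows.win y q ℓ₀ ≡ Windows.win y q′ ℓ₀ → q ≡ q′)
  (X C : ℕ) (X+C<Z : X + C < Z) (L+C≤X : 2 + (ℓ₀ + ℓ₀) + C ≤ X)
  where

  open Windows y

  -- If a word `u ++ win 0 j` has length at least `L`, then `j ≥ ℓ₀`, or `u` has at least `2 + ℓ₀`
  -- letters. The 2 is for spacers: one letter is the leading 0, and `ℓ₀ + 1` letters 1 remain, too
  -- long a run for the sequence.
  L : ℕ
  L = 2 + (ℓ₀ + ℓ₀)

  private
    X<Z : X < Z
    X<Z = ≤-trans (s≤s (m≤m+n X C)) X+C<Z

    ℓ₀≤L : ℓ₀ ≤ L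
    ℓ₀≤L = ≤-trans (m≤m+n ℓ₀ ℓ₀) (m≤n+m (ℓ₀ + ℓ₀) 2)

  win-length-≡ : ∀ {q ℓ q′ ℓ′} → win q ℓ ≡ win q′ ℓ′ → ℓ ≡ ℓ′
  win-length-≡ {q} {ℓ} {q′} {ℓ′} eq = trans (sym (length-win q ℓ)) (trans (cong length eq) (length-win q′ ℓ′))

  ++-win-length : ∀ u {q j q′ k} → u ++ win q j ≡ win q′ k → length u + j ≡ k
  ++-win-length u {q} {j} {q′} {k} eq = begin
    length u + j                 ≡⟨ cong (length u +_) (length-win q j) ⟨
    length u + length (win q j)  ≡⟨ length-++ u ⟨
    length (u ++ win q j)        ≡⟨ cong length eq ⟩
    length (win q′ k)            ≡⟨ length-win q′ k ⟩
    k                            ∎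
    where open ≡-Reasoning

  win-prefix : ∀ {u s q ℓ} → u ++ s ≡ win q ℓ → u ≡ win q (length u)
  win-prefix {u} eq = proj₁ (win-split u eq)

  win-suffix : ∀ u {q′ k q ℓ} → u ++ win q′ k ≡ win q ℓ → win q′ k ≡ win (q + length u) k
  win-suffix u {q′} {k} {q} eq =
    trans (proj₂ (win-split u eq)) (cong (win (q + length u)) (length-win q′ k))

  win-position : ∀ {q q′ ℓ} → ℓ₀ ≤ ℓ → q < Z → q′ < Z → win q ℓ ≡ win q′ ℓ → q ≡ q′
  win-position {q} {q′} {ℓ} ℓ₀≤ℓ q<Z q′<Z eq = distinct q<Z q′<Z
    (trans (win-prefix (trans (win-++ q ℓ₀) (trans (cong (win q) (m+[n∸m]≡n ℓ₀≤ℓ)) eq)))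
           (cong (win q′) (length-win q ℓ₀)))

  private
    run-prefix : ∀ {j k s} → j ≤ k → replicate k true ≡ win s k → replicate j true ≡ win s j
    run-prefix {zero} _ _ = refl
    run-prefix {suc j} (s≤s j≤k) eq with ∷-injective eq
    ... | true≡ , eq′ = cong₂ _∷_ true≡ (run-prefix j≤k eq′)

  -- In a run of more than `ℓ₀` letters 1 the windows of length `ℓ₀` at `s` and `suc s` coincide.
  no-long-run : ∀ {s k} → ℓ₀ < k → suc s < Z → replicate k true ≢ win s k
  no-long-run {s} {suc k} (s≤s ℓ₀≤k) 1+s<Z eq = contradiction
    (distinct (<-trans (n<1+n s) 1+s<Z) 1+s<Z
      (trans (sym (run-prefix (m≤n⇒m≤1+n ℓ₀≤k) eq)) (run-prefix ℓ₀≤k (proj₂ (∷-injective eq)))))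
    (<⇒≢ (n<1+n s))

  private
    replicate-suffix : ∀ u {es} m → replicate m true ≡ u ++ es → replicate (length es) true ≡ es
    replicate-suffix [] m refl = cong (λ k → replicate k true) (length-replicate m)
    replicate-suffix (_ ∷ u) (suc m) eq = replicate-suffix u m (proj₂ (∷-injective eq))

    long-left : ∀ {a j k} → a + j ≡ k → L ≤ k → j < ℓ₀ → 2 + ℓ₀ ≤ a
    long-left {a} {j} refl L≤k j<ℓ₀ = +-cancelʳ-≤ ℓ₀ (2 + ℓ₀) a
      (≤-trans L≤k (+-monoʳ-≤ a (<⇒≤ j<ℓ₀)))

  -- Recognising the origin of a long block of 0w.

  spacer : ℕ → Word
  spacer m = false ∷ replicate m true

  -- What the parser of 0w has read of an unclosed block when a new copy begins: the end of the
  -- preceding copy, which reaches beyond `X`, or a spacer just inserted.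
  data Pending : Word → Set where
    leftover : ∀ {q ℓ} → X < q + ℓ → q + ℓ < Z → Pending (win q ℓ)
    inserted : ∀ m → Pending (spacer m)

  -- Here c stands for the copy y[0..X+c+1) in which the block ends.
  data Block : Set where
    initial : Word → Block
    inside  : (c q ℓ : ℕ) → Block
    cross   : (c : ℕ) (u : Word) (k : ℕ) → Block

  word : Block → Word
  word (initial m) = m
  word (inside c q ℓ) = win q ℓ
  word (cross c u k) = u ++ win 0 k

  Admissible : Block → Set
  Admissible (initial m) = m ≡ spacer 0 ⊎ ∃ λ i → i ≤ X × m ≡ win 0 i
  Admissible (inside c q ℓ) = 1 ≤ q × q + ℓ < Z
  Admissible (cross c u k) = Pending u × k ≤ X

  private
    -- A long leftover determines its position and hence ends beyond `X`; a long spacer contains a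
    -- run of letters 1 that the sequence lacks.
    long-pending : ∀ {u z} → Pending u → 2 + ℓ₀ ≤ length u → z + length u ≤ X → u ≢ win z (length u)
    long-pending {z = z} (leftover {q} {ℓ} X< <Z) long fits eq rewrite length-win q ℓ =
      <⇒≱ X< (subst (λ p → p + ℓ ≤ X) (sym q≡z) fits)
      where
      q≡z : q ≡ z
      q≡z = win-position (≤-trans (m≤n+m ℓ₀ 2) long) (≤-<-trans (m≤m+n q ℓ) <Z)
                         (≤-<-trans (m+n≤o⇒m≤o z fits) X<Z) eq
    long-pending {z = z} (inserted m) (s≤s long) fits eq rewrite length-replicate m {true} = no-long-run long
      (≤-<-trans (≤-trans (≤-trans (≤-reflexive (+-comm 2 z)) (+-monoʳ-≤ z (s≤s (≤-trans (s≤s z≤n) long)))) fits) X<Z)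
      (proj₂ (∷-injective eq))

    -- A proper suffix of a leftover sits at a positive position, and one of a spacer is a run of
    -- letters 1.
    pending-suffix : ∀ {v} u {es} → Pending v → v ≡ u ++ es → u ≢ [] → 2 + ℓ₀ ≤ length es → es ≢ win 0 (length es)
    pending-suffix [] _ _ u≢[] _ _ = u≢[] refl
    pending-suffix u@(_ ∷ u′) {es} (leftover {q} {ℓ} _ <Z) eq _ long es≡ =
      contradiction (trans 0≡ (+-suc q _)) λ ()
      where
      len : length u + length es ≡ ℓ
      len = trans (sym (length-++ u)) (trans (cong length (sym eq)) (length-win q ℓ))
      0≡ : 0 ≡ q + length u
      0≡ = win-position (≤-trans (m≤n+m ℓ₀ 2) long) (≤-<-trans z≤n <Z)
        (≤-<-trans (+-monoʳ-≤ q (≤-trans (m≤m+n (length u) (length es)) (≤-reflexive len))) <Z)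
        (trans (sym es≡) (proj₂ (win-split u (sym eq))))
    pending-suffix (_ ∷ u′) (inserted m) eq _ long es≡ =
      no-long-run (<⇒≤ long) (≤-<-trans 1≤X X<Z)
        (trans (replicate-suffix u′ m (proj₂ (∷-injective eq))) es≡)
      where
      1≤X : 1 ≤ X
      1≤X = ≤-trans (s≤s z≤n) L+C≤X

  -- `spacer 0` is too short. Any other origin would put a window of length at least `ℓ₀` at two
  -- positions, or a long pending word within the first `X` letters.
  inside-of : ∀ {b z k} → Admissible b → 1 ≤ z → z + k ≤ X → L ≤ k → word b ≡ win z k →
              ∃ λ c → b ≡ inside c z k
  inside-of {initial m} {z} {k} (inj₁ refl) _ _ L≤k eq =
    contradiction (≤-trans L≤k (≤-reflexive (sym (trans (cong length eq) (length-win z k))))) λ { (s≤s ()) }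
  inside-of {initial m} {z} {k} (inj₂ (i , i≤X , refl)) 1≤z fits L≤k eq with win-length-≡ eq
  ... | refl = contradiction
    (win-position (≤-trans ℓ₀≤L L≤k) (≤-<-trans z≤n X<Z) (≤-<-trans (m+n≤o⇒m≤o z fits) X<Z) eq) (<⇒≢ 1≤z)
  inside-of {inside c q ℓ} {z} (_ , <Z) _ fits L≤k eq with win-length-≡ eq
  ... | refl with win-position (≤-trans ℓ₀≤L L≤k) (≤-<-trans (m≤m+n q ℓ) <Z) (≤-<-trans (m+n≤o⇒m≤o z fits) X<Z) eq
  ... | refl = c , refl
  inside-of {cross c u j} {z} {k} (pending , _) 1≤z fits L≤k eq with ℓ₀ ≤? j
  ... | yes ℓ₀≤j = contradiction
    (win-position ℓ₀≤j (≤-<-trans z≤n X<Z)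
      (≤-<-trans (≤-trans (+-monoʳ-≤ z (m+n≤o⇒m≤o _ (≤-reflexive (++-win-length u eq)))) fits) X<Z) (win-suffix u eq))
    (<⇒≢ (≤-trans 1≤z (m≤m+n z (length u))))
  ... | no ℓ₀≰j = contradiction (win-prefix eq)
    (long-pending pending (long-left (++-win-length u eq) L≤k (≰⇒> ℓ₀≰j))
      (≤-trans (+-monoʳ-≤ z (m+n≤o⇒m≤o _ (≤-reflexive (++-win-length u eq)))) fits))

  private
    not-shifted : ∀ u {q k ℓ} → u ≢ [] → ℓ₀ ≤ k → q + ℓ < Z → win q ℓ ≡ u ++ win 0 k →
                  ∀ {a} {A : Set a} → A
    not-shifted u {q} {k} {ℓ} u≢[] ℓ₀≤k <Z eq = contradiction
      (win-position ℓ₀≤k (≤-<-trans z≤n <Z)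
        (≤-<-trans (+-monoʳ-≤ q (m+n≤o⇒m≤o _ (≤-reflexive (++-win-length u (sym eq))))) <Z) (win-suffix u (sym eq)))
      (<⇒≢ (≤-trans (nonempty u≢[]) (m≤n+m (length u) q)))

  -- Two different splittings would either place a prefix of `y` of length at least `ℓ₀` at a
  -- positive position, or make a long proper suffix of a pending word a prefix of `y`.
  cross-of : ∀ {b u k} → Admissible b → u ≢ [] → L ≤ k → k ≤ X → word b ≡ u ++ win 0 k →
             ∃₂ λ c u′ → b ≡ cross c u′ k
  cross-of {initial m} {u} {k} (inj₁ refl) _ L≤k _ eq = contradiction
    (≤-trans L≤k (≤-trans (m≤n+m k (length u)) (≤-reflexive
      (trans (cong (length u +_) (sym (length-win 0 k))) (trans (sym (length-++ u)) (cong length (sym eq)))))))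
    λ { (s≤s ()) }
  cross-of {initial m} {u} {k} (inj₂ (i , i≤X , refl)) u≢[] L≤k k≤X eq =
    not-shifted u u≢[] (≤-trans ℓ₀≤L L≤k) (≤-<-trans i≤X X<Z) eq
  cross-of {inside c q ℓ} {u} {k} (_ , <Z) u≢[] L≤k k≤X eq =
    not-shifted u u≢[] (≤-trans ℓ₀≤L L≤k) <Z eq
  cross-of {cross c u′ j} {u} {k} (pending , j≤X) u≢[] L≤k k≤X eq with ≤-total (length u′) (length u)
  ... | inj₁ u′≤u with ++-split u′ eq u′≤u
  ...   | [] , _ , eq′ = c , u′ , cong (cross c u′) (win-length-≡ eq′)
  ...   | es@(_ ∷ _) , _ , eq′ = not-shifted es (λ ()) (≤-trans ℓ₀≤L L≤k) (≤-<-trans j≤X X<Z) eq′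
  cross-of {cross c u′ j} {u} {k} (pending , j≤X) u≢[] L≤k k≤X eq | inj₂ u≤u′ with ++-split u (sym eq) u≤u′
  ...   | [] , _ , eq′ = c , u′ , cong (cross c u′) (win-length-≡ (sym eq′))
  ...   | es@(_ ∷ _) , u′≡ , eq′ with ℓ₀ ≤? j
  ...     | yes ℓ₀≤j = not-shifted es (λ ()) ℓ₀≤j (≤-<-trans k≤X X<Z) eq′
  ...     | no ℓ₀≰j = contradiction (win-prefix (sym eq′))
    (pending-suffix u pending u′≡ u≢[] (long-left (++-win-length es (sym eq′)) L≤k (≰⇒> ℓ₀≰j)))

  -- Invariants of the parsing of 0w.

  Before : ℕ → Block → Set
  Before c (initial _) = ⊤
  Before c (inside c′ _ _) = c′ < c
  Before c (cross c′ _ _) = c′ < c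

  Upto : ℕ → ℕ → Block → Set
  Upto c t (initial _) = ⊤
  Upto c t (inside c′ q ℓ) = c′ < c ⊎ (c′ ≡ c × q + ℓ ≤ t)
  Upto c t (cross c′ _ _) = c′ ≤ c

  words : List Block → List Word
  words = map word

  Covered : List Block → ℕ → ℕ → Set
  Covered log c p = ∃₂ λ q ℓ → inside c q ℓ ∈ log × q ≤ p × p < q + ℓ

  -- The block starting at t continues beyond the end of its copy, hence beyond X.
  Unfinished : List Block → ℕ → Set
  Unfinished log p = ∃ λ t → 1 ≤ t × t ≤ p × win t (X ∸ t) ∈ words log

  EndsAt : List Block → ℕ → ℕ → Set
  EndsAt log c t = ∃₂ λ q ℓ → q + ℓ ≡ t × inside c q ℓ ∈ log

  -- Each copy is read from left to right after a single crossing block, which ends at `L + C` at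
  -- the latest. The block before an inside block may be this crossing block, whence the exception
  -- in `predecessor`.
  record Consistent (log : List Block) : Set where
    field
      dict        : Dict (words log)
      admissible  : ∀ {b} → b ∈ log → Admissible b
      disjoint    : ∀ {c q ℓ q′ ℓ′} → inside c q ℓ ∈ log → inside c q′ ℓ′ ∈ log →
                    q + ℓ ≤ q′ ⊎ q′ + ℓ′ ≤ q ⊎ (q ≡ q′ × ℓ ≡ ℓ′)
      one-entry   : ∀ {c u k u′ k′} → cross c u k ∈ log → cross c u′ k′ ∈ log → k ≡ k′
      predecessor : ∀ {c q ℓ} → inside c q ℓ ∈ log → q ≤ L + C ⊎ EndsAt log c q

  record Completed (c : ℕ) (log : List Block) : Set where
    field
      consistent : Consistent log
      before     : ∀ {b} → b ∈ log → Before c b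
      covered    : ∀ {c′} → c′ < c → ∀ {p} → L + C ≤ p → p < X → Covered log c′ p ⊎ Unfinished log p
    open Consistent consistent public

  record Active (c t : ℕ) (log : List Block) : Set where
    field
      consistent : Consistent log
      upto       : ∀ {b} → b ∈ log → Upto c t b
      covered    : ∀ {c′} → c′ < c → ∀ {p} → L + C ≤ p → p < X → Covered log c′ p ⊎ Unfinished log p
      covering   : ∀ {p} → L + C ≤ p → p < t → Covered log c p
      positive   : 1 ≤ t
      reached    : t ≤ L + C ⊎ EndsAt log c t
    open Consistent consistent public

  private
    covered-there : ∀ {log c p b} → Covered log c p → Covered (b ∷ log) c p
    covered-there (q , ℓ , b∈ , bounds) = q , ℓ , there b∈ , bounds

    unfinished-there : ∀ {log p b} → Unfinished log p → Unfinished (b ∷ log) p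
    unfinished-there (t , 1≤t , t≤p , w∈) = t , 1≤t , t≤p , there w∈

    either-there : ∀ {log c p b} → Covered log c p ⊎ Unfinished log p → Covered (b ∷ log) c p ⊎ Unfinished (b ∷ log) p
    either-there {b = b} = Sum.map covered-there (unfinished-there {b = b})

    ends-there : ∀ {log c t b} → EndsAt log c t → EndsAt (b ∷ log) c t
    ends-there (q , ℓ , eq , b∈) = q , ℓ , eq , there b∈

  _∈?_ : (u : Word) (D : List Word) → Dec (u ∈ D)
  _∈?_ = DecMembership._∈?_ (≡-dec _≟B_)

  block-of : ∀ {log x} → x ∈ words log → ∃ λ b → b ∈ log × word b ≡ x
  block-of x∈ with ∈-map⁻ word x∈
  ... | b , b∈ , x≡ = b , b∈ , sym x≡

  -- A dictionary repeats no word, so a word also determines the copy in which it was recorded.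
  word-injective : ∀ {log b b′} → Dict (words log) → b ∈ log → b′ ∈ log → word b ≡ word b′ → b ≡ b′
  word-injective _ (here refl) (here refl) _ = refl
  word-injective (_ , _ , ∉ , _) (here refl) (there b′∈) eq = contradiction (subst (_∈ _) (sym eq) (∈-map⁺ word b′∈)) ∉
  word-injective (_ , _ , ∉ , _) (there b∈) (here refl) eq = contradiction (subst (_∈ _) eq (∈-map⁺ word b∈)) ∉
  word-injective (_ , _ , _ , dict) (there b∈) (there b′∈) eq = word-injective dict b∈ b′∈ eq

  private
    nonempty-win : ∀ {q k} → 1 ≤ k → win q k ≢ []
    nonempty-win {k = suc _} _ ()

    ∷-dict-win : ∀ {D t k} → Dict D → 1 ≤ k → win t k ∉ D → (∀ {j} → 1 ≤ j → j < k → win t j ∈ D) → Dict (win t k ∷ D)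
    ∷-dict-win {D} {t} {k} dict 1≤k ∉D before = nonempty-win 1≤k , prefixes , ∉D , dict
      where
      prefixes : ∀ p → NonemptyPrefix p (win t k) → p ∈ win t k ∷ D
      prefixes p (p≢[] , s , eq) with m≤n⇒m<n∨m≡n (m+n≤o⇒m≤o (length p)
        (≤-reflexive (trans (sym (length-++ p)) (trans (cong length eq) (length-win t k)))))
      ... | inj₁ p<k = there (subst (_∈ D) (sym (win-prefix eq)) (before (nonempty p≢[]) p<k))
      ... | inj₂ p≡k = here (trans (win-prefix eq) (cong (win t) p≡k))

    ∷-dict-cross : ∀ {D u k} → Dict D → u ∈ D → 1 ≤ k → u ++ win 0 k ∉ D →
                   (∀ {j} → 1 ≤ j → j < k → u ++ win 0 j ∈ D) → Dict ((u ++ win 0 k) ∷ D)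
    ∷-dict-cross {D} {u} {k} dict u∈D 1≤k ∉D before = not-empty , prefixes , ∉D , dict
      where
      not-empty : u ++ win 0 k ≢ []
      not-empty eq = []∉dict dict (subst (_∈ D) (++-conicalˡ u _ eq) u∈D)
      prefixes : ∀ p → NonemptyPrefix p (u ++ win 0 k) → p ∈ (u ++ win 0 k) ∷ D
      prefixes p (p≢[] , s , eq) with ≤-total (length p) (length u)
      ... | inj₁ p≤u with ++-split p {cs = u} eq p≤u
      ...   | es , u≡ , _ = there (prefix-closed dict (subst (_∈ D) u≡ u∈D) p≢[])
      prefixes p (p≢[] , s , eq) | inj₂ u≤p with ++-split u {cs = p} (sym eq) u≤p
      ...   | [] , refl , _ = there (subst (_∈ D) (sym (++-identityʳ u)) u∈D)
      ...   | es@(_ ∷ _) , refl , eq′ with m≤n⇒m<n∨m≡n (m+n≤o⇒m≤o (length es)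
        (≤-reflexive (trans (sym (length-++ es)) (trans (cong length (sym eq′)) (length-win 0 k)))))
      ...     | inj₁ es<k = there (subst (λ v → u ++ v ∈ D) (sym (win-prefix (sym eq′))) (before (s≤s z≤n) es<k))
      ...     | inj₂ es≡k = here (cong (u ++_) (trans (win-prefix (sym eq′)) (cong (win 0) es≡k)))

  -- Reading one copy in 0w.

  -- Words u ++ win 0 k with k ≥ L are recorded at pairwise different copies, one for each k.
  entry-bound : ∀ {c log u} → Completed c log → c ≤ C → u ≢ [] →
                ¬ (∀ {k} → 1 ≤ k → k ≤ L + C → u ++ win 0 k ∈ words log)
  entry-bound {c} {log} {u} completed c≤C u≢[] all∈ = contradiction
    (≤-trans (≤-trans (≤-reflexive (sym (length-upTo (suc C))))
      (≤-trans (pigeonhole (λ e c′ → ∃ λ u′ → cross c′ u′ (L + e) ∈ log) (Unique.upTo⁺ (suc C)) entry injective)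
      (≤-reflexive (length-upTo c)))) c≤C)
    1+n≰n
    where
    open Completed completed
    entry : ∀ {e} → e ∈ upTo (suc C) → ∃ λ c′ → c′ ∈ upTo c × ∃ λ u′ → cross c′ u′ (L + e) ∈ log
    entry {e} e∈ with +-monoʳ-≤ L (s≤s⁻¹ (∈-upTo⁻ e∈))
    ... | L+e≤L+C with block-of (all∈ (s≤s z≤n) L+e≤L+C)
    ... | b , b∈ , eq with cross-of (admissible b∈) u≢[] (m≤m+n L e) (≤-trans L+e≤L+C L+C≤X) eq
    ... | c′ , u′ , refl = c′ , ∈-upTo⁺ (before b∈) , u′ , b∈
    injective : ∀ {e e′ c′} → (∃ λ u′ → cross c′ u′ (L + e) ∈ log) → (∃ λ u′ → cross c′ u′ (L + e′) ∈ log) → e ≡ e′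
    injective (_ , b∈) (_ , b′∈) = +-cancelˡ-≡ L _ _ (one-entry b∈ b′∈)

  -- By `entry-bound` some `u ++ win 0 k` with `k ≤ L + C` is unknown; the shortest one is the
  -- crossing block, so the copy cannot be swallowed whole.
  enter : ∀ {c log u} → Completed c log → c < C → u ∈ words log → Pending u →
          ∃ λ k → 1 ≤ k × k ≤ L + C × Active c k (cross c u k ∷ log)
  enter {c} {log} {u} completed c<C u∈ pending
    with firstFailure (λ k → (u ++ win 0 k) ∈? words log) (L + C)
  ... | inj₁ all∈ = ⊥-elim (entry-bound completed (<⇒≤ c<C) (λ { refl → []∉dict (Completed.dict completed) u∈ }) all∈)
  ... | inj₂ (k , 1≤k , k≤L+C , ∉D , earlier) = k , 1≤k , k≤L+C , record
    { consistent = record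
      { dict = ∷-dict-cross dict u∈ 1≤k ∉D earlier
      ; admissible = λ { (here refl) → pending , ≤-trans k≤L+C L+C≤X ; (there b∈) → admissible b∈ }
      ; disjoint = λ { (there b∈) (there b′∈) → disjoint b∈ b′∈ }
      ; one-entry = λ where
          (here refl) (here refl) → refl
          (here refl) (there b∈) → contradiction (before b∈) 1+n≰n
          (there b∈) (here refl) → contradiction (before b∈) 1+n≰n
          (there b∈) (there b′∈) → one-entry b∈ b′∈
      ; predecessor = λ { (there b∈) → Sum.map₂ ends-there (predecessor b∈) }
      }
    ; upto = λ { (here refl) → ≤-refl ; (there b∈) → weaken _ (before b∈) }
    ; covered = λ c′<c L+C≤p p<X → either-there (covered c′<c L+C≤p p<X)
    ; covering = λ L+C≤p p<k → contradiction (≤-trans p<k (≤-trans k≤L+C L+C≤p)) 1+n≰n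
    ; positive = 1≤k
    ; reached = inj₁ k≤L+C
    }
    where
    open Completed completed
    weaken : ∀ b → Before c b → Upto c k b
    weaken (initial _) _ = tt
    weaken (inside _ _ _) c′<c = inj₁ c′<c
    weaken (cross _ _ _) c′<c = <⇒≤ c′<c

  add-inside : ∀ {c t k log} → Active c t log → t + k < Z → 1 ≤ k → win t k ∉ words log →
               (∀ {j} → 1 ≤ j → j < k → win t j ∈ words log) → Active c (t + k) (inside c t k ∷ log)
  add-inside {c} {t} {k} {log} active t+k<Z 1≤k ∉D earlier = record
    { consistent = record
      { dict = ∷-dict-win dict 1≤k ∉D earlier
      ; admissible = λ { (here refl) → positive , t+k<Z ; (there b∈) → admissible b∈ }
      ; disjoint = λ where
          (here refl) (here refl) → inj₂ (inj₂ (refl , refl))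
          (here refl) (there b∈) → inj₂ (inj₁ (past b∈))
          (there b∈) (here refl) → inj₁ (past b∈)
          (there b∈) (there b′∈) → disjoint b∈ b′∈
      ; one-entry = λ { (there b∈) (there b′∈) → one-entry b∈ b′∈ }
      ; predecessor = λ where
          (here refl) → Sum.map₂ ends-there reached
          (there b∈) → Sum.map₂ ends-there (predecessor b∈)
      }
    ; upto = λ { (here refl) → inj₂ (refl , ≤-refl) ; (there b∈) → weaken _ (upto b∈) }
    ; covered = λ c′<c L+C≤p p<X → either-there (covered c′<c L+C≤p p<X)
    ; covering = cover
    ; positive = ≤-trans positive (m≤m+n t k)
    ; reached = inj₂ (t , k , refl , here refl)
    }
    where
    open Active active
    past : ∀ {q ℓ} → inside c q ℓ ∈ log → q + ℓ ≤ t
    past b∈ with upto b∈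
    ... | inj₁ c<c = contradiction c<c 1+n≰n
    ... | inj₂ (_ , ≤t) = ≤t
    weaken : ∀ b → Upto c t b → Upto c (t + k) b
    weaken (initial _) _ = tt
    weaken (inside _ _ _) (inj₁ c′<c) = inj₁ c′<c
    weaken (inside _ _ _) (inj₂ (c′≡c , ≤t)) = inj₂ (c′≡c , ≤-trans ≤t (m≤m+n t k))
    weaken (cross _ _ _) c′≤c = c′≤c
    cover : ∀ {p} → L + C ≤ p → p < t + k → Covered (inside c t k ∷ log) c p
    cover {p} L+C≤p p<t+k with p <? t
    ... | yes p<t = covered-there (covering L+C≤p p<t)
    ... | no p≮t = t , k , here refl , ≮⇒≥ p≮t , p<t+k

  Carried : List Block → Word → Set
  Carried log u = u ≡ [] ⊎ (u ∈ words log × Pending u)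

  -- Blocks are cut off greedily from the remaining `e` letters, with `n` as a bound for the
  -- recursion. Once every prefix of the rest is known, the rest is carried over into what follows
  -- the copy.
  finish : ∀ n {c e t log} → c < C → e ≤ n → t + e ≡ X + suc c → Active c t log →
           ∃₂ λ log′ u → Completed (suc c) log′ × Carried log′ u × (∀ {x} → x ∈ words log → x ∈ words log′) ×
             spell (words log′) ++ u ≡ spell (words log) ++ win t e
  finish n {c} {e} {t} {log} c<C e≤n t+e≡ active
    with firstFailure (λ k → win t k ∈? words log) e
  ... | inj₁ all∈ = log , win t e , record
      { consistent = consistent
      ; before = λ b∈ → strengthen _ (upto b∈)
      ; covered = cover
      }
    , carried , (λ x∈ → x∈) , refl
    where
    open Active active
    E<Z : X + suc c < Z
    E<Z = ≤-<-trans (+-monoʳ-≤ X c<C) X+C<Z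
    X<E : X < X + suc c
    X<E = m<m+n X (s≤s z≤n)
    strengthen : ∀ b → Upto c t b → Before (suc c) b
    strengthen (initial _) _ = tt
    strengthen (inside _ _ _) (inj₁ c′<c) = m≤n⇒m≤1+n c′<c
    strengthen (inside _ _ _) (inj₂ (refl , _)) = ≤-refl
    strengthen (cross _ _ _) c′≤c = s≤s c′≤c
    -- The copy has `X + suc c` letters, so the part of the leftover up to `X` is one of its known
    -- prefixes.
    tail∈ : ∀ {p} → t ≤ p → p < X → win t (X ∸ t) ∈ words log
    tail∈ t≤p p<X = all∈ (m<n⇒0<n∸m (≤-<-trans t≤p p<X))
      (m≤n+o⇒m∸n≤o X t (≤-trans (<⇒≤ X<E) (≤-reflexive (sym t+e≡))))
    cover : ∀ {c′} → c′ < suc c → ∀ {p} → L + C ≤ p → p < X → Covered log c′ p ⊎ Unfinished log p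
    cover c′<1+c {p} L+C≤p p<X with m≤n⇒m<n∨m≡n (s≤s⁻¹ c′<1+c) | p <? t
    ... | inj₁ c′<c | _ = covered c′<c L+C≤p p<X
    ... | inj₂ refl | yes p<t = inj₁ (covering L+C≤p p<t)
    ... | inj₂ refl | no p≮t = inj₂ (t , positive , ≮⇒≥ p≮t , tail∈ (≮⇒≥ p≮t) p<X)
    carried : Carried log (win t e)
    carried with e ≟ 0
    ... | yes refl = inj₁ refl
    ... | no e≢0 = inj₂ (all∈ (n≢0⇒n>0 e≢0) ≤-refl ,
      leftover (subst (X <_) (sym t+e≡) X<E) (subst (_< Z) (sym t+e≡) E<Z))
  finish zero _ e≤0 _ _ | inj₂ (k , 1≤k , k≤e , _) = contradiction (≤-trans 1≤k (≤-trans k≤e e≤0)) λ ()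
  finish (suc n) {c} {e} {t} {log} c<C e≤n t+e≡ active | inj₂ (k , 1≤k , k≤e , ∉D , earlier)
    with finish n {e = e ∸ k} c<C rest≤n rest≡ (add-inside active t+k<Z 1≤k ∉D earlier)
    where
    rest≤n : e ∸ k ≤ n
    rest≤n = ≤-trans (∸-monoʳ-≤ e 1≤k) (∸-monoˡ-≤ 1 e≤n)
    rest≡ : t + k + (e ∸ k) ≡ X + suc c
    rest≡ = trans (+-assoc t k _) (trans (cong (t +_) (m+[n∸m]≡n k≤e)) t+e≡)
    t+k<Z : t + k < Z
    t+k<Z = ≤-<-trans (≤-trans (+-monoʳ-≤ t k≤e) (≤-reflexive t+e≡)) (≤-<-trans (+-monoʳ-≤ X c<C) X+C<Z)
  ... | log′ , u , completed , carried , grows , text = log′ , u , completed , carried , grows ∘ there ,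
    trans text (trans (++-assoc (spell (words log)) (win t k) _)
      (cong (spell (words log) ++_) (trans (win-++ t k) (cong (win t) (m+[n∸m]≡n k≤e)))))

  -- The parsing of w.

  -- The blocks of w so far are y[0..1), …, y[0..n) and the first m spacers.
  record Source (n m : ℕ) (W : List Word) : Set where
    field
      dict     : Dict W
      prefixes : ∀ {i} → 1 ≤ i → i ≤ n → win 0 i ∈ W
      spacers  : ∀ {k} → k < m → spacer k ∈ W
      only     : ∀ {x} → x ∈ W → (∃ λ i → i ≤ n × x ≡ win 0 i) ⊎ (∃ λ k → k < m × x ≡ spacer k)
      size     : length W ≡ n + m

  private
    win≢spacer : ∀ {i k} → win 0 i ≢ spacer k
    win≢spacer {suc i} eq = contradiction (trans (sym y0) (proj₁ (∷-injective eq))) λ ()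

    spacer-injective : ∀ {k m} → spacer k ≡ spacer m → k ≡ m
    spacer-injective {k} {m} eq =
      trans (sym (length-replicate k)) (trans (cong length (proj₂ (∷-injective eq))) (length-replicate m))

    replicate-prefix : ∀ p {s} m → p ++ s ≡ replicate m true → ∃ λ k → k ≤ m × p ≡ replicate k true
    replicate-prefix [] m _ = 0 , z≤n , refl
    replicate-prefix (_ ∷ p) (suc m) eq with ∷-injective eq
    ... | refl , eq′ with replicate-prefix p m eq′
    ... | k , k≤m , p≡ = suc k , s≤s k≤m , cong (true ∷_) p≡

    spacer-snoc : ∀ m → spacer m ++ true ∷ [] ≡ spacer (suc m)
    spacer-snoc m = cong (false ∷_) (snoc m)
      where
      snoc : ∀ m → replicate m true ++ true ∷ [] ≡ replicate (suc m) true
      snoc zero = refl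
      snoc (suc m) = cong (true ∷_) (snoc m)

  source-[] : Source 0 0 []
  source-[] = record
    { dict = tt
    ; prefixes = λ 1≤i i≤0 → contradiction (≤-trans 1≤i i≤0) λ ()
    ; spacers = λ ()
    ; only = λ ()
    ; size = refl
    }

  source-prefix : ∀ {n m W} → Source n m W → Source (suc n) m (win 0 (suc n) ∷ W)
  source-prefix {n} {m} {W} source = record
    { dict = ∷-dict-win dict (s≤s z≤n) new (λ 1≤j j≤n → prefixes 1≤j (s≤s⁻¹ j≤n))
    ; prefixes = prefixes′
    ; spacers = λ k<m → there (spacers k<m)
    ; only = λ where
        (here refl) → inj₁ (suc n , ≤-refl , refl)
        (there x∈) → Sum.map₁ (λ (i , i≤n , eq) → i , m≤n⇒m≤1+n i≤n , eq) (only x∈)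
    ; size = cong suc size
    }
    where
    open Source source
    new : win 0 (suc n) ∉ W
    new x∈ with only x∈
    ... | inj₁ (i , i≤n , eq) = contradiction (≤-trans (≤-reflexive (win-length-≡ {0} {suc n} {0} eq)) i≤n) 1+n≰n
    ... | inj₂ (k , _ , eq) = win≢spacer {suc n} eq
    prefixes′ : ∀ {i} → 1 ≤ i → i ≤ suc n → win 0 i ∈ win 0 (suc n) ∷ W
    prefixes′ 1≤i i≤1+n with m≤n⇒m<n∨m≡n i≤1+n
    ... | inj₁ i<1+n = there (prefixes 1≤i (s≤s⁻¹ i<1+n))
    ... | inj₂ refl = here refl

  source-spacer : ∀ {n m W} → Source n m W → Source n (suc m) (spacer m ∷ W)
  source-spacer {n} {m} {W} source = record
    { dict = (λ ()) , block-prefixes , new , dict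
    ; prefixes = λ 1≤i i≤n → there (prefixes 1≤i i≤n)
    ; spacers = spacers′
    ; only = λ where
        (here refl) → inj₂ (m , ≤-refl , refl)
        (there x∈) → Sum.map₂ (λ (k , k<m , eq) → k , m≤n⇒m≤1+n k<m , eq) (only x∈)
    ; size = trans (cong suc size) (sym (+-suc n m))
    }
    where
    open Source source
    new : spacer m ∉ W
    new x∈ with only x∈
    ... | inj₁ (i , _ , eq) = win≢spacer {i} (sym eq)
    ... | inj₂ (k , k<m , eq) = contradiction (sym (spacer-injective eq)) (<⇒≢ k<m)
    spacers′ : ∀ {k} → k < suc m → spacer k ∈ spacer m ∷ W
    spacers′ k<1+m with m≤n⇒m<n∨m≡n (s≤s⁻¹ k<1+m)
    ... | inj₁ k<m = there (spacers k<m)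
    ... | inj₂ refl = here refl
    block-prefixes : ∀ p → NonemptyPrefix p (spacer m) → p ∈ spacer m ∷ W
    block-prefixes [] (p≢[] , _) = contradiction refl p≢[]
    block-prefixes (b ∷ p) (_ , s , eq) with ∷-injective eq
    ... | refl , eq′ with replicate-prefix p m eq′
    ... | k , k≤m , refl = spacers′ (s≤s k≤m)

  private
    with-prefixes : ℕ → List Word → List Word
    with-prefixes zero W = W
    with-prefixes (suc n) W = win 0 (suc n) ∷ with-prefixes n W

    source-prefixes : ∀ n {m W} → Source 0 m W → Source n m (with-prefixes n W)
    source-prefixes zero source = source
    source-prefixes (suc n) source = source-prefix (source-prefixes n source)

    spell-with-prefixes : ∀ n → spell (with-prefixes n (spacer 0 ∷ [])) ≡ false ∷ spell (with-prefixes n [])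
    spell-with-prefixes zero = refl
    spell-with-prefixes (suc n) = cong (_++ win 0 (suc n)) (spell-with-prefixes n)

    words-initial : ∀ D → words (map initial D) ≡ D
    words-initial [] = refl
    words-initial (x ∷ D) = cong (x ∷_) (words-initial D)

  -- Both parsings side by side.

  -- W consists of the blocks of w and log of those of 0w, cur being the block of 0w not yet finished.
  record State (c : ℕ) : Set where
    field
      log       : List Block
      cur       : Word
      W         : List Word
      m         : ℕ
      completed : Completed c log
      carried   : Carried log cur
      source    : Source (X + c) m W
      text      : spell (words log) ++ cur ≡ false ∷ spell W
      ahead     : spacer m ∈ words log
      m≤c       : m ≤ c

  -- The prepended 0 is `spacer 0` and forms the first block of 0w; the first `X` prefixes are then
  -- blocks in both parsings. This is the lead of one spacer that 0w keeps.
  start : State 0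
  start = record
    { log = map initial D₀
    ; cur = []
    ; W = with-prefixes X []
    ; m = 0
    ; completed = record
      { consistent = record
        { dict = subst Dict (sym (words-initial D₀)) D.dict
        ; admissible = λ b∈ → admissible (∈-map⁻ initial b∈)
        ; disjoint = λ b∈ → ⊥-elim (not-inside (∈-map⁻ initial b∈))
        ; one-entry = λ b∈ → ⊥-elim (not-cross (∈-map⁻ initial b∈))
        ; predecessor = λ b∈ → ⊥-elim (not-inside (∈-map⁻ initial b∈))
        }
      ; before = λ b∈ → before (∈-map⁻ initial b∈)
      ; covered = λ ()
      }
    ; carried = inj₁ refl
    ; source = subst (λ n → Source n 0 (with-prefixes X [])) (sym (+-identityʳ X)) (source-prefixes X source-[])
    ; text = trans (++-identityʳ _) (trans (cong spell (words-initial D₀)) (spell-with-prefixes X))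
    ; ahead = subst (spacer 0 ∈_) (sym (words-initial D₀)) (D.spacers (s≤s z≤n))
    ; m≤c = z≤n
    }
    where
    D₀ = with-prefixes X (spacer 0 ∷ [])
    module D = Source (source-prefixes X (source-spacer source-[]))
    FromInitial : Block → Set
    FromInitial b = ∃ λ x → x ∈ D₀ × b ≡ initial x
    admissible : ∀ {b} → FromInitial b → Admissible b
    admissible (x , x∈ , refl) with D.only x∈
    ... | inj₁ found = inj₂ found
    ... | inj₂ (zero , _ , x≡) = inj₁ x≡
    ... | inj₂ (suc _ , s≤s () , _)
    before : ∀ {b} → FromInitial b → Before 0 b
    before (_ , _ , refl) = tt
    not-inside : ∀ {c q ℓ} → ¬ FromInitial (inside c q ℓ)
    not-inside (_ , _ , ())
    not-cross : ∀ {c u k} → ¬ FromInitial (cross c u k)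
    not-cross (_ , _ , ())

  -- If a block of 0w ends at the end of a copy, a spacer is inserted in w. It is new in w, while 0w, which
  -- is one spacer ahead, only finds it in its dictionary and has to read on into the next copy.
  record Ready (c : ℕ) : Set where
    field
      log       : List Block
      u         : Word
      W         : List Word
      m         : ℕ
      completed : Completed c log
      u∈        : u ∈ words log
      pending   : Pending u
      source    : Source (X + c) m W
      text      : spell (words log) ++ u ≡ false ∷ spell W
      ahead     : ∀ {D} → (∀ {x} → x ∈ words log → x ∈ D) → u ++ true ∷ [] ∈ D → spacer m ∈ D
      m≤1+c     : m ≤ suc c

  ready : ∀ {c} → State c → Ready c
  ready {c} state with State.carried state
  ... | inj₂ (cur∈ , pending) = record
    { completed = completed ; u∈ = cur∈ ; pending = pending ; source = source ; text = text
    ; ahead = λ grows _ → grows ahead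
    ; m≤1+c = m≤n⇒m≤1+n m≤c
    }
    where open State state
  ... | inj₁ cur≡[] = record
    { completed = completed ; u∈ = ahead ; pending = inserted m ; source = source-spacer source
    ; text = cong (_++ spacer m) (trans (sym (++-identityʳ _)) (trans (cong (spell (words log) ++_) (sym cur≡[])) text))
    ; ahead = λ {D} _ → subst (_∈ D) (spacer-snoc m)
    ; m≤1+c = s≤s m≤c
    }
    where open State state

  advance : ∀ {c} → c < C → State c → State (suc c)
  advance {c} c<C state with ready state
  ... | record { log = log ; u = u ; W = W ; m = m ; completed = completed ; u∈ = u∈ ; pending = pending
               ; source = source ; text = text ; ahead = ahead ; m≤1+c = m≤1+c }
    with enter completed c<C u∈ pending
  ... | k , 1≤k , k≤L+C , active with finish (X + suc c ∸ k) c<C ≤-refl (m+[n∸m]≡n k≤) active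
    where
    k≤ : k ≤ X + suc c
    k≤ = ≤-trans k≤L+C (≤-trans L+C≤X (m≤m+n X (suc c)))
  ... | log′ , cur , completed′ , carried , grows , text′ = record
    { completed = completed′
    ; carried = carried
    ; source = subst (λ n → Source n m (win 0 n ∷ W)) (sym (+-suc X c)) (source-prefix source)
    ; text = begin
        spell (words log′) ++ cur                             ≡⟨ text′ ⟩
        (spell (words log) ++ u ++ win 0 k) ++ win k e        ≡⟨ cong (_++ win k e) (++-assoc (spell (words log)) u _) ⟨
        ((spell (words log) ++ u) ++ win 0 k) ++ win k e      ≡⟨ ++-assoc (spell (words log) ++ u) _ _ ⟩
        (spell (words log) ++ u) ++ win 0 k ++ win k e        ≡⟨ cong₂ _++_ text (trans (win-++ 0 k) (cong (win 0) (m+[n∸m]≡n k≤))) ⟩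
        (false ∷ spell W) ++ win 0 (X + suc c)                ∎
    -- The copy begins with 1, so the crossing block has the prefix `u ++ true ∷ []`, known by
    -- prefix-closure. If `u` is the spacer just inserted, this is the next spacer, and the lead is
    -- restored.
    ; ahead = ahead (grows ∘ there) (prefix-closed (Completed.dict completed′)
        (subst (_∈ words log′) (split-first u 1≤k) (grows (here refl))) (λ eq → contradiction (++-conicalʳ u _ eq) λ ()))
    ; m≤c = m≤1+c
    }
    where
    open ≡-Reasoning
    e = X + suc c ∸ k
    k≤ : k ≤ X + suc c
    k≤ = ≤-trans k≤L+C (≤-trans L+C≤X (m≤m+n X (suc c)))
    split-first : ∀ u {k} → 1 ≤ k → u ++ win 0 k ≡ (u ++ true ∷ []) ++ win 1 (k ∸ 1)
    split-first u {suc k} _ = trans (cong (λ b → u ++ b ∷ win 1 k) y0) (sym (++-assoc u (true ∷ []) (win 1 k)))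

  reach : ∀ c → c ≤ C → State c
  reach zero _ = start
  reach (suc c) c<C = advance c<C (reach c (<⇒≤ c<C))

  -- Counting the blocks of 0w.

  longest : ℕ → ℕ
  longest H = L + (H + (H + L))

  module Count {log : List Block} (completed : Completed C log) where
    open Completed completed

    private
      D : List Word
      D = words log

    shorten : ∀ {z k ℓ} → 1 ≤ k → k ≤ ℓ → win z ℓ ∈ D → win z k ∈ D
    shorten {z} {k} {ℓ} 1≤k k≤ℓ w∈ = prefix-closed dict
      (subst (_∈ D) (sym (trans (win-++ z k) (cong (win z) (m+[n∸m]≡n k≤ℓ)))) w∈) (nonempty-win 1≤k)

    located : ∀ {z k} → 1 ≤ z → z + k ≤ X → L ≤ k → win z k ∈ D → ∃ λ c → c < C × inside c z k ∈ log
    located 1≤z fits L≤k w∈ with block-of w∈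
    ... | b , b∈ , eq with inside-of (admissible b∈) 1≤z fits L≤k eq
    ... | c , refl = c , before b∈ , b∈

    same-start : ∀ {c z e e′} → inside c z (L + e) ∈ log → inside c z (L + e′) ∈ log → e ≡ e′
    same-start {z = z} b∈ b′∈ with disjoint b∈ b′∈
    ... | inj₁ ≤z = contradiction ≤z (m+1+n≰m z)
    ... | inj₂ (inj₁ ≤z) = contradiction ≤z (m+1+n≰m z)
    ... | inj₂ (inj₂ (_ , eq)) = +-cancelˡ-≡ L _ _ eq

    -- Its prefixes of lengths `L` to `L + C` would be `C + 1` blocks starting at `z`, all in
    -- different copies, of which there are only `C`.
    short-from : ∀ {z} → 1 ≤ z → z + (L + C) ≤ X → win z (L + C) ∉ D
    short-from {z} 1≤z fits w∈ = contradiction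
      (≤-trans (≤-reflexive (sym (length-upTo (suc C))))
        (≤-trans (pigeonhole (λ e c → inside c z (L + e) ∈ log) (Unique.upTo⁺ (suc C)) image same-start)
                 (≤-reflexive (length-upTo C))))
      1+n≰n
      where
      image : ∀ {e} → e ∈ upTo (suc C) → ∃ λ c → c ∈ upTo C × inside c z (L + e) ∈ log
      image {e} e∈ with +-monoʳ-≤ L (s≤s⁻¹ (∈-upTo⁻ e∈))
      ... | L+e≤ with located 1≤z (≤-trans (+-monoʳ-≤ z L+e≤) fits) (m≤m+n L e) (shorten (s≤s z≤n) L+e≤ w∈)
      ... | c , c<C , b∈ = c , ∈-upTo⁺ c<C , b∈

    -- With v = H + (H + L): if win z (L + v) were a block, then z would be the start of v + 1 blocks of different copies, whose
    -- predecessors start at different q. The H + 1 or more of these q below z - (H + L), together with the H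
    -- cut-short words win q (z - j - q), give more than C blocks across the position z - (H + L).
    short-beyond : ∀ {H z} → .{{NonZero H}} → C ≡ H * H → L + C < z → z + longest H ≤ X →
                   win z (longest H) ∉ D
    short-beyond {H} {z} C≡H² L+C<z fits w∈ = contradiction too-many 1+n≰n
      where
      v b a : ℕ
      v = H + (H + L)
      -- A word from some `q < a` to `z` keeps at least `L` letters, and still reaches beyond `a`,
      -- when fewer than `H` letters are cut off its end.
      b = H + L
      a = z ∸ b
      1≤H : 1 ≤ H
      1≤H = >-nonZero⁻¹ H
      H≤C : H ≤ C
      H≤C = ≤-trans (m≤m*n H H) (≤-reflexive (sym C≡H²))
      a+b≡z : a + b ≡ z
      a+b≡z = m∸n+n≡m (≤-trans (+-monoˡ-≤ L H≤C) (≤-trans (≤-reflexive (+-comm C L)) (<⇒≤ L+C<z)))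
      z≤X : z ≤ X
      z≤X = m+n≤o⇒m≤o z fits
      1≤z : 1 ≤ z
      1≤z = ≤-trans (s≤s z≤n) L+C<z

      Far : ℕ → Set
      Far q = 1 ≤ q × win q (z ∸ q) ∈ D
      far? : Decidable Far
      far? q = (1 ≤? q) ×-dec (win q (z ∸ q) ∈? D)
      far near : List ℕ
      far = filter far? (upTo a)
      near = map (a +_) (upTo b)

      Precedes : ℕ → ℕ → Set
      Precedes e q = ∃₂ λ c ℓ → q + ℓ ≡ z × inside c z (L + e) ∈ log × inside c q ℓ ∈ log

      precedes : ∀ {e} → e ∈ upTo (suc v) → ∃ λ q → q ∈ far ++ near × Precedes e q
      precedes {e} e∈ with +-monoʳ-≤ L (s≤s⁻¹ (∈-upTo⁻ e∈))
      ... | L+e≤ with located 1≤z (≤-trans (+-monoʳ-≤ z L+e≤) fits) (m≤m+n L e) (shorten (s≤s z≤n) L+e≤ w∈)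
      ... | c , _ , b∈ with predecessor b∈
      ... | inj₁ z≤L+C = contradiction z≤L+C (<⇒≱ L+C<z)
      ... | inj₂ (q , zero , _ , b′∈) = contradiction (∈-map⁺ word b′∈) ([]∉dict dict)
      ... | inj₂ (q , ℓ@(suc _) , q+ℓ≡z , b′∈) = q , q∈ , c , ℓ , q+ℓ≡z , b∈ , b′∈
        where
        q<z : q < a + b
        q<z = ≤-trans (m<m+n q (s≤s z≤n)) (≤-reflexive (trans q+ℓ≡z (sym a+b≡z)))
        q∈ : q ∈ far ++ near
        q∈ with q <? a
        ... | yes q<a = ∈-++⁺ˡ (∈-filter⁺ far? (∈-upTo⁺ q<a) (proj₁ (admissible b′∈) ,
          subst (λ k → win q k ∈ D) (trans (sym (m+n∸m≡n q ℓ)) (cong (_∸ q) q+ℓ≡z)) (∈-map⁺ word b′∈)))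
        ... | no q≮a = ∈-++⁺ʳ far (subst (_∈ near) (m+[n∸m]≡n (≮⇒≥ q≮a))
          (∈-map⁺ (a +_) (∈-upTo⁺ (m<n+o⇒m∸n<o q a {{>-nonZero (≤-trans 1≤H (m≤m+n H L))}} q<z))))

      -- The predecessor is the word from `q` to `z`, recorded in one copy only, and in that copy a
      -- single block starts at `z`.
      precedes-injective : ∀ {e e′ q} → Precedes e q → Precedes e′ q → e ≡ e′
      precedes-injective {q = q} (c , ℓ , eq , b∈ , pred∈) (c′ , ℓ′ , eq′ , b′∈ , pred′∈)
        with +-cancelˡ-≡ q ℓ ℓ′ (trans eq (sym eq′))
      ... | refl with word-injective dict pred∈ pred′∈ refl
      ... | refl = same-start b∈ b′∈

      Across : ℕ × ℕ → ℕ → Set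
      Across (q , j) c = ∃ λ ℓ → q + ℓ + j ≡ z × q < a × j < H × inside c q ℓ ∈ log

      across : ∀ {qj} → qj ∈ cartesianProduct far (upTo H) → ∃ λ c → c ∈ upTo C × Across qj c
      across {q , j} qj∈ with ∈-cartesianProduct⁻ far (upTo H) qj∈
      ... | q∈far , j∈ with ∈-filter⁻ far? {xs = upTo a} q∈far
      ... | q∈ , 1≤q , w∈ = result (located 1≤q q+ℓ≤X L≤ℓ (shorten (≤-trans (s≤s z≤n) L≤ℓ) ℓ≤ w∈))
        where
        j<H = ∈-upTo⁻ j∈
        q<a = ∈-upTo⁻ q∈
        ℓ = z ∸ (q + j)
        q+j+L≤z : q + j + L ≤ z
        q+j+L≤z = ≤-trans (≤-reflexive (+-assoc q j L))
          (≤-trans (+-mono-≤ (<⇒≤ q<a) (+-monoˡ-≤ L (<⇒≤ j<H))) (≤-reflexive a+b≡z))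
        L≤ℓ : L ≤ ℓ
        L≤ℓ = m+n≤o⇒m≤o∸n L (≤-trans (≤-reflexive (+-comm L (q + j))) q+j+L≤z)
        ℓ≤ : ℓ ≤ z ∸ q
        ℓ≤ = ∸-monoʳ-≤ z (m≤m+n q j)
        q+ℓ+j≡z : q + ℓ + j ≡ z
        q+ℓ+j≡z = trans (+-assoc q ℓ j) (trans (cong (q +_) (+-comm ℓ j))
          (trans (sym (+-assoc q j ℓ)) (m+[n∸m]≡n (m+n≤o⇒m≤o (q + j) q+j+L≤z))))
        q+ℓ≤X : q + ℓ ≤ X
        q+ℓ≤X = ≤-trans (m≤m+n (q + ℓ) j) (≤-trans (≤-reflexive q+ℓ+j≡z) z≤X)
        result : (∃ λ c → c < C × inside c q ℓ ∈ log) → ∃ λ c → c ∈ upTo C × Across (q , j) c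
        result (c , c<C , b∈) = c , ∈-upTo⁺ c<C , ℓ , q+ℓ+j≡z , q<a , j<H , b∈

      past-a : ∀ q ℓ {j} → q + ℓ + j ≡ z → j < H → a < q + ℓ
      past-a q ℓ {j} eq j<H = +-cancelʳ-< j a (q + ℓ) (≤-trans (+-monoʳ-< a (≤-trans j<H (m≤m+n H L)))
        (≤-reflexive (trans a+b≡z (sym eq))))

      -- All these blocks start before `a` and end after it, so two of them in the same copy
      -- coincide.
      across-injective : ∀ {qj qj′ c} → Across qj c → Across qj′ c → qj ≡ qj′
      across-injective {q , j} {q′ , j′} (ℓ , eq , q<a , j<H , b∈) (ℓ′ , eq′ , q′<a , j′<H , b′∈)
        with disjoint b∈ b′∈
      ... | inj₁ ≤q′ = contradiction (<-≤-trans (past-a q ℓ eq j<H) ≤q′) (<-asym q′<a)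
      ... | inj₂ (inj₁ ≤q) = contradiction (<-≤-trans (past-a q′ ℓ′ eq′ j′<H) ≤q) (<-asym q<a)
      ... | inj₂ (inj₂ (refl , refl)) = cong (q ,_) (+-cancelˡ-≡ (q + ℓ) j j′ (trans eq (sym eq′)))

      few-far : length far ≤ H
      few-far = *-cancelʳ-≤ (length far) H H (begin
        length far * H                          ≡⟨ cong (length far *_) (length-upTo H) ⟨
        length far * length (upTo H)            ≡⟨ length-cartesianProduct far (upTo H) ⟨
        length (cartesianProduct far (upTo H))  ≤⟨ pigeonhole Across
          (Unique.cartesianProduct⁺ (Unique.filter⁺ far? (Unique.upTo⁺ a)) (Unique.upTo⁺ H)) across across-injective ⟩
        length (upTo C)                         ≡⟨ length-upTo C ⟩
        C                                       ≡⟨ C≡H² ⟩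
        H * H                                   ∎)
        where open ≤-Reasoning

      too-many : suc v ≤ v
      too-many = begin
        suc v                      ≡⟨ length-upTo (suc v) ⟨
        length (upTo (suc v))      ≤⟨ pigeonhole Precedes (Unique.upTo⁺ (suc v)) precedes precedes-injective ⟩
        length (far ++ near)       ≡⟨ length-++ far ⟩
        length far + length near   ≡⟨ cong (length far +_) (trans (length-map (a +_) (upTo b)) (length-upTo b)) ⟩
        length far + b             ≤⟨ +-monoˡ-≤ b few-far ⟩
        v                          ∎
        where open ≤-Reasoning

    -- In every copy, the blocks across the positions 2(L + C) + M r are different.
    many-blocks : ∀ {H R} → .{{NonZero H}} → C ≡ H * H → L + C + (L + C) + longest H * R ≤ X → C * R ≤ length log
    many-blocks {H} {R} C≡H² fits = begin
      C * R                                        ≡⟨ cong₂ _*_ (length-upTo C) (length-upTo R) ⟨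
      length (upTo C) * length (upTo R)            ≡⟨ length-cartesianProduct (upTo C) (upTo R) ⟨
      length (cartesianProduct (upTo C) (upTo R))  ≤⟨ pigeonhole Crossing
        (Unique.cartesianProduct⁺ (Unique.upTo⁺ C) (Unique.upTo⁺ R)) crossing crossing-injective ⟩
      length log                                   ∎
      where
      open ≤-Reasoning
      M : ℕ
      M = longest H

      point : ℕ → ℕ
      -- Points at distance `M` cannot share a block of length at most `M`.
      point r = L + C + (L + C) + M * r

      Crossing : ℕ × ℕ → Block → Set
      Crossing (c , r) b = ∃₂ λ q ℓ → b ≡ inside c q ℓ × q ≤ point r × point r < q + ℓ × ℓ ≤ M

      crossing : ∀ {cr} → cr ∈ cartesianProduct (upTo C) (upTo R) → ∃ λ b → b ∈ log × Crossing cr b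
      crossing {c , r} cr∈ with ∈-cartesianProduct⁻ (upTo C) (upTo R) cr∈
      ... | c∈ , r∈ = cover (covered (∈-upTo⁻ c∈) L+C≤p p<X)
        where
        p : ℕ
        p = point r
        p+M≤X : p + M ≤ X
        p+M≤X = ≤-trans (≤-reflexive (trans (+-assoc (L + C + (L + C)) (M * r) M)
          (cong (L + C + (L + C) +_) (trans (+-comm (M * r) M) (sym (*-suc M r))))))
          (≤-trans (+-monoʳ-≤ (L + C + (L + C)) (*-monoʳ-≤ M (∈-upTo⁻ r∈))) fits)
        p<X : p < X
        p<X = ≤-trans (m<m+n p (s≤s z≤n)) p+M≤X
        2L+2C≤p : L + C + (L + C) ≤ p
        2L+2C≤p = m≤m+n _ (M * r)
        L+C≤p : L + C ≤ p
        L+C≤p = ≤-trans (m≤m+n (L + C) (L + C)) 2L+2C≤p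

        not-long : ∀ {q ℓ} → 1 ≤ q → q ≤ p → p < q + ℓ → win q ℓ ∈ D → ℓ < M
        not-long {q} {ℓ} 1≤q q≤p p<q+ℓ w∈ with ℓ <? M | q ≤? L + C
        ... | yes ℓ<M | _ = ℓ<M
        ... | no ℓ≮M | no q≰ = contradiction (shorten (s≤s z≤n) (≮⇒≥ ℓ≮M) w∈)
          (short-beyond C≡H² (≰⇒> q≰) (≤-trans (+-monoˡ-≤ M q≤p) p+M≤X))
        -- A block that starts by `L + C` and reaches beyond `2(L + C)` has length at least `L + C`,
        -- which `short-from` excludes.
        ... | no _ | yes q≤ = contradiction (shorten (s≤s z≤n) L+C≤ℓ w∈)
          (short-from 1≤q (≤-trans (+-monoˡ-≤ (L + C) q≤) (≤-trans 2L+2C≤p (<⇒≤ p<X))))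
          where
          L+C≤ℓ : L + C ≤ ℓ
          L+C≤ℓ = +-cancelˡ-≤ q (L + C) ℓ (≤-trans (+-monoˡ-≤ (L + C) q≤) (≤-trans 2L+2C≤p (<⇒≤ p<q+ℓ)))

        cover : Covered log c p ⊎ Unfinished log p → ∃ λ b → b ∈ log × Crossing (c , r) b
        cover (inj₁ (q , ℓ , b∈ , q≤p , p<q+ℓ)) =
          inside c q ℓ , b∈ , q , ℓ , refl , q≤p , p<q+ℓ , <⇒≤ (not-long (proj₁ (admissible b∈)) q≤p p<q+ℓ (∈-map⁺ word b∈))
        -- An unfinished word over `p` reaches up to `X`; as `p + M ≤ X`, it has at least `M`
        -- letters and would be too long.
        cover (inj₂ (t , 1≤t , t≤p , w∈)) = contradiction
          (not-long 1≤t t≤p (≤-trans p<X (≤-reflexive (sym (m+[n∸m]≡n (≤-trans t≤p (<⇒≤ p<X)))))) w∈)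
          (≤⇒≯ (m+n≤o⇒m≤o∸n M (≤-trans (+-monoʳ-≤ M t≤p) (≤-trans (≤-reflexive (+-comm M p)) p+M≤X))))

      crossing-injective : ∀ {cr cr′ b} → Crossing cr b → Crossing cr′ b → cr ≡ cr′
      crossing-injective {c , r} {c′ , r′} (q , ℓ , refl , q≤p , p<q+ℓ , ℓ≤M) (_ , _ , refl , q≤p′ , p′<q+ℓ , _) =
        cong (c ,_) (≤-antisym (close q≤p′ p<q+ℓ) (close q≤p p′<q+ℓ))
        where
        close : ∀ {r r′} → q ≤ point r′ → point r < q + ℓ → r ≤ r′
        close {r} {r′} q≤p′ p<q+ℓ = s≤s⁻¹ (*-cancelˡ-< M r (suc r′) (+-cancelˡ-< (L + C + (L + C)) _ _ (begin-strict
          point r                                <⟨ p<q+ℓ ⟩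
          q + ℓ                                  ≤⟨ +-mono-≤ q≤p′ ℓ≤M ⟩
          point r′ + M                           ≡⟨ +-assoc (L + C + (L + C)) (M * r′) M ⟩
          L + C + (L + C) + (M * r′ + M)         ≡⟨ cong (L + C + (L + C) +_) (trans (+-comm (M * r′) M) (sym (*-suc M r′))) ⟩
          L + C + (L + C) + M * suc r′           ∎)))

  -- The word w with its two complete parsings.

  Catastrophe : ℕ → Set
  Catastrophe R = ∃ λ (w : Word) → X ≤ length w ×
    ∃ λ ms → ∃ λ ns → IsLZParsing w ms × IsLZParsing (false ∷ w) ns ×
      length w ≤ (X + C + C) * (X + C) × dictSize ms ≤ X + C + C × C * R ≤ dictSize ns

  -- In w there are `X + C` prefixes and at most one spacer for each of the last `C` copies, each of
  -- length at most `X + C`. The parsing of 0w may end with an unfinished block.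
  catastrophe : ∀ {H R} → .{{NonZero H}} → C ≡ H * H → L + C + (L + C) + longest H * R ≤ X → Catastrophe R
  catastrophe {H} {R} C≡H² fits with reach C ≤-refl
  ... | record { log = log ; W = W ; m = m ; completed = completed ; carried = carried
               ; source = source ; text = text ; m≤c = m≤C }
    with unfinished-block (Completed.dict completed) (Sum.map₂ proj₁ carried)
  ... | ms , concat≡ , blocks = spell W , long , W ʳ++ [] , words log ʳ++ ms ,
    (trans (concat-ʳ++ W) (++-identityʳ (spell W)) , lzBlocks-ʳ++ W dict tt) ,
    (trans (concat-ʳ++ (words log)) (trans (cong (spell (words log) ++_) concat≡) text) ,
     lzBlocks-ʳ++ (words log) (Completed.dict completed) blocks) ,
    ≤-trans (length-spell-≤ W short) (*-monoˡ-≤ (X + C) few) ,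
    ≤-trans (length-deduplicate (≡-dec _≟B_) (W ʳ++ []))
      (≤-trans (≤-reflexive (trans (length-ʳ++ W) (+-identityʳ (length W)))) few) ,
    ≤-trans (Count.many-blocks completed C≡H² fits)
      (≤-trans (≤-reflexive (sym (length-map word log))) (length≤dictSize ms (Completed.dict completed)))
    where
    open Source source
    few : length W ≤ X + C + C
    few = ≤-trans (≤-reflexive size) (+-monoʳ-≤ (X + C) m≤C)
    long : X ≤ length (spell W)
    long = ≤-trans (≤-trans (m≤m+n X C) (≤-trans (m≤m+n (X + C) m) (≤-reflexive (sym size)))) (length≤spell dict)
    short : ∀ {x} → x ∈ W → length x ≤ X + C
    short x∈ with only x∈
    ... | inj₁ (i , i≤ , refl) = ≤-trans (≤-reflexive (length-win 0 i)) i≤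
    ... | inj₂ (k , k<m , refl) = ≤-trans (≤-reflexive (cong suc (length-replicate k)))
      (≤-trans k<m (≤-trans m≤C (m≤n+m C X)))

-- Choice of the parameters and the final estimate.

private
  -- The least `X` that `catastrophe` admits for `L = H`, `C = H * H` and `R = H`.
  prefixCount : ℕ → ℕ
  prefixCount H = H + H * H + (H + H * H) + (H + (H + (H + H))) * H

  prefixCount-≤ : ∀ H → 2 ≤ H → prefixCount H + H * H ≤ 8 * (H * H)
  prefixCount-≤ H 2≤H = begin
    prefixCount H + H * H    ≡⟨ solve 1 (λ h → h :+ h :* h :+ (h :+ h :* h) :+ (h :+ (h :+ (h :+ h))) :* h :+ h :* h
                                  := con 2 :* h :+ con 7 :* (h :* h)) refl H ⟩
    2 * H + 7 * (H * H)      ≤⟨ +-monoˡ-≤ (7 * (H * H)) (*-monoˡ-≤ H 2≤H) ⟩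
    8 * (H * H)              ∎
    where open ≤-Reasoning

  -- The left-hand side is `2 + 4F`, the value of `L` for windows of two frames.
  H≤9G : ∀ {G} → 26 ≤ G → 2 + (6 + (G + G) + (6 + (G + G)) + (6 + (G + G) + (6 + (G + G)))) ≤ 9 * G
  H≤9G {G} 26≤G = begin
    2 + (6 + (G + G) + (6 + (G + G)) + (6 + (G + G) + (6 + (G + G))))
      ≡⟨ solve 1 (λ g → let f = con 6 :+ (g :+ g) in con 2 :+ (f :+ f :+ (f :+ f)) := con 26 :+ con 8 :* g) refl G ⟩
    26 + 8 * G  ≤⟨ +-monoˡ-≤ (8 * G) 26≤G ⟩
    9 * G       ∎
    where open ≤-Reasoning

  -- About `8 * (H * H)` positions are used, of order `G * G`, against a supply of order
  -- `G * G * G`. With `400 ≤ G` the factor `6 + (G + G)` is at least 806 and exceeds 648, which is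
  -- 8 times the square of 9.
  enough-positions : ∀ {G H} → 400 ≤ G → H ≤ 9 * G → 8 * (H * H) < G * G * (6 + (G + G))
  enough-positions {G} {H} 400≤G H≤ = begin-strict
    8 * (H * H)              ≤⟨ *-monoʳ-≤ 8 (*-mono-≤ H≤ H≤) ⟩
    8 * (9 * G * (9 * G))    ≡⟨ solve 1 (λ g → con 8 :* (con 9 :* g :* (con 9 :* g)) := g :* g :* con 648) refl G ⟩
    G * G * 648              <⟨ *-monoʳ-< (G * G) {{m*n≢0 G G {{nz}} {{nz}}}} (≤-trans (≤ᵇ⇒≤ 649 806 tt) (+-monoʳ-≤ 6 (+-mono-≤ 400≤G 400≤G))) ⟩
    G * G * (6 + (G + G))    ∎
    where
    open ≤-Reasoning
    nz : NonZero G
    nz = >-nonZero (≤-trans (s≤s z≤n) 400≤G)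

  -- The product on the left is at most 9 · 8 · 9 = 648 times the sixth power of `H`, and `e * e` is
  -- at least that power; 1225 is the square of 35.
  final-estimate : ∀ {n d e H Y} → n ≤ (Y + H * H) * Y → d ≤ Y + H * H → H * H * H ≤ e → Y ≤ 8 * (H * H) →
            n * d ≤ 1225 * (e * e)
  final-estimate {n} {d} {e} {H} {Y} n≤ d≤ e≥ Y≤ = begin
    n * d                                              ≤⟨ *-mono-≤ n≤ d≤ ⟩
    (Y + H * H) * Y * (Y + H * H)                      ≤⟨ *-mono-≤ (*-mono-≤ Y+≤ Y≤) Y+≤ ⟩
    (8 * (H * H) + H * H) * (8 * (H * H)) * (8 * (H * H) + H * H)
      ≡⟨ solve 1 (λ h → let s = h :* h in (con 8 :* s :+ s) :* (con 8 :* s) :* (con 8 :* s :+ s)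
           := con 648 :* (s :* h :* (s :* h))) refl H ⟩
    648 * (H * H * H * (H * H * H))                    ≤⟨ *-mono-≤ (≤ᵇ⇒≤ 648 1225 tt) (*-mono-≤ e≥ e≥) ⟩
    1225 * (e * e)                                     ∎
    where
    open ≤-Reasoning
    Y+≤ : Y + H * H ≤ 8 * (H * H) + H * H
    Y+≤ = +-monoˡ-≤ (H * H) Y≤

  long-catastrophe : ∀ {y ℓ₀ Z H} → y 0 ≡ true → H ≡ 2 + (ℓ₀ + ℓ₀) → 8 * (H * H) < Z →
    (∀ {q q′} → q < Z → q′ < Z → Windows.win y q ℓ₀ ≡ Windows.win y q′ ℓ₀ → q ≡ q′) →
    ∃ λ (w : Word) → H ≤ length w × ∃ λ ms → ∃ λ ns → IsLZParsing w ms × IsLZParsing (false ∷ w) ns ×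
      length w * dictSize ms ≤ 1225 * (dictSize ns * dictSize ns)
  long-catastrophe {y} {ℓ₀} {Z} {H} y0 H≡ 8H²<Z distinct =
    estimate (catastrophe {H} {H} {{H≢0}} refl fits)
    where
    2≤H : 2 ≤ H
    2≤H = ≤-trans (m≤m+n 2 (ℓ₀ + ℓ₀)) (≤-reflexive (sym H≡))
    H≢0 : NonZero H
    H≢0 = >-nonZero (<⇒≤ 2≤H)
    2H+2C≤X : H + H * H + (H + H * H) ≤ prefixCount H
    2H+2C≤X = m≤m+n (H + H * H + (H + H * H)) ((H + (H + (H + H))) * H)
    L+C≤X : 2 + (ℓ₀ + ℓ₀) + H * H ≤ prefixCount H
    L+C≤X = subst (λ l → l + H * H ≤ prefixCount H) H≡ (≤-trans (m≤m+n (H + H * H) (H + H * H)) 2H+2C≤X)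
    open Construction y y0 ℓ₀ Z distinct (prefixCount H) (H * H)
      (≤-<-trans (prefixCount-≤ H 2≤H) 8H²<Z) L+C≤X
    fits : L + H * H + (L + H * H) + longest H * H ≤ prefixCount H
    fits = ≤-reflexive (cong (λ l → l + H * H + (l + H * H) + (l + (H + (H + l))) * H) (sym H≡))
    estimate : Catastrophe H → ∃ λ (w : Word) → H ≤ length w × ∃ λ ms → ∃ λ ns →
      IsLZParsing w ms × IsLZParsing (false ∷ w) ns × length w * dictSize ms ≤ 1225 * (dictSize ns * dictSize ns)
    estimate (w , X≤w , ms , ns , parse-w , parse-0w , w≤ , ms≤ , ns≥) =
      w , ≤-trans (≤-trans (m≤m+n H (H * H)) (≤-trans (m≤m+n (H + H * H) (H + H * H)) 2H+2C≤X)) X≤w ,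
      ms , ns , parse-w , parse-0w ,
      final-estimate {H = H} w≤ ms≤ ns≥ (prefixCount-≤ H 2≤H)

  framed-catastrophe : ∀ {N G} → 400 ≤ G → N ≤ G → ∃ λ (w : Word) → N ≤ length w ×
    ∃ λ ms → ∃ λ ns → IsLZParsing w ms × IsLZParsing (false ∷ w) ns ×
    length w * dictSize ms ≤ 1225 * (dictSize ns * dictSize ns)
  framed-catastrophe {N} {G} 400≤G N≤G =
    map₂ (map₁ (≤-trans N≤H)) (long-catastrophe refl refl (enough-positions 400≤G (H≤9G 26≤G)) frames-distinct)
    where
    instance
      G≢0 : NonZero G
      G≢0 = >-nonZero (≤-trans (s≤s z≤n) 400≤G)
    open Frames G
    26≤G : 26 ≤ G
    26≤G = ≤-trans (≤ᵇ⇒≤ 26 400 tt) 400≤G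
    N≤H : N ≤ 2 + (F + F + (F + F))
    N≤H = begin
      N                      ≤⟨ N≤G ⟩
      G                      ≤⟨ m≤m+n G G ⟩
      G + G                  ≤⟨ m≤n+m (G + G) 6 ⟩
      F                      ≤⟨ m≤m+n F F ⟩
      F + F                  ≤⟨ m≤m+n (F + F) (F + F) ⟩
      F + F + (F + F)        ≤⟨ m≤n+m (F + F + (F + F)) 2 ⟩
      2 + (F + F + (F + F))  ∎
      where open ≤-Reasoning

-- Solutions of unbounded length are infinitely many. Squaring the inequality removes the root and
-- turns 1/35 into the factor 1225.
mainTheorem3 : ∀ (N : ℕ) → ∃ λ (w : Word) → N ≤ length w ×
    ∃ λ ms → ∃ λ ns → IsLZParsing w ms × IsLZParsing (false ∷ w) ns ×
    length w * dictSize ms ≤ 1225 * (dictSize ns * dictSize ns)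
mainTheorem3 N = framed-catastrophe (m≤m+n 400 N) (m≤n+m N 400)
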